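{- There exists an assignment, to each constant $c$ of $\mathsf{HA}^\omega$ of type $\sigma$ (at each type instance), of a closed $\mathsf{HA}^\omega$-term $c^\alpha$ of type $\sigma^+$, such that the following holds. Fix an injective assignment of a variable $x^\alpha$ of type $\sigma^+$ to each variable $x$ of type $\sigma$, and define the $\alpha$-translation of terms by $x^\alpha := x^\alpha$, $c^\alpha := c^\alpha$, $(st)^\alpha := s^\alpha * t^\alpha$, and of formulas of $\mathsf{H}\text{ - }\mathsf{HA}^\omega$ by $(\mathrm{Ext}_\sigma(t))^\alpha := \mathrm{dom}_\sigma(t^\alpha)$; $(s\equiv_\sigma t)^\alpha := s^\alpha \equiv_{\sigma^+} t^\alpha$; $(s =_\sigma t)^\alpha := \neg\exists z:\sigma^-.\,\mathrm{app}_\sigma(s^\alpha,t^\alpha,z)$; $\bot^\alpha := \bot$; $(\varphi\,\square\,\psi)^\alpha := \varphi^\alpha\,\square\,\psi^\alpha$ for $\square\in\{\wedge,\vee,\to\}$; $(\exists x:\sigma.\varphi)^\alpha := \exists x^\alpha:\sigma^+.\varphi^\alpha$; $(\forall x:\sigma.\varphi)^\alpha := \forall x^\alpha:\sigma^+.\varphi^\alpha$. Then for every formula $\varphi$ of the language of $\mathsf{H}\text{ - }\mathsf{HA}^\omega$: if $\mathsf{HE}\text{ - }\mathsf{HA}^\omega \vdash \varphi$, then $\mathsf{HA}^\omega \vdash \varphi^\alpha$.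
   Context: Finite types are generated by: $0$ is a type; if $\sigma,\tau$ are types, so are $\sigma\times\tau$ and $\sigma\to\tau$ ($\to$ associates to the right). $\mathsf{HA}^\omega$ is the many-sorted intuitionistic first-order theory whose sorts are the finite types. Its terms are built from variables of each type and, for all types $\rho,\sigma,\tau$, the constants $\mathsf{k}:\rho\to\sigma\to\rho$, $\mathsf{s}:(\rho\to\sigma\to\tau)\to(\rho\to\sigma)\to(\rho\to\tau)$, $\mathsf{pair}:\sigma\to\tau\to\sigma\times\tau$, $\mathsf{fst}:\sigma\times\tau\to\sigma$, $\mathsf{snd}:\sigma\times\tau\to\tau$, $0:0$, $S:0\to0$, $\mathsf{R}:\sigma\to(0\to\sigma\to\sigma)\to0\to\sigma$, by application (if $s:\sigma\to\tau$, $t:\sigma$ then $st:\tau$; application associates to the left). Atomic formulas are $\bot$ and $s\equiv_\sigma t$; $\neg\varphi$ abbreviates $\varphi\to\bot$. Axioms: $\equiv_\sigma$ is reflexive, symmetric and transitive; $x\equiv x'\to y\equiv y'\to xy\equiv x'y'$; $\mathsf{k}xy\equiv x$; $\mathsf{s}xyz\equiv xz(yz)$; $\mathsf{fst}(\mathsf{pair}\,xy)\equiv x$; $\mathsf{snd}(\mathsf{pair}\,xy)\equiv y$; $\mathsf{R}xy0\equiv x$; $\mathsf{R}xy(Sm)\equiv ym(\mathsf{R}xym)$; $Sx\equiv_0Sy\to x\equiv_0y$; $\neg(Sx\equiv_0 0)$; induction $\varphi(0)\to\forall x:0(\varphi(x)\to\varphi(Sx))\to\forall x:0\,\varphi(x)$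 for all formulas. Surjective pairing is not assumed. $\mathsf{H}\text{ - }\mathsf{HA}^\omega$ extends the language with, for each type $\sigma$, a unary predicate $\mathrm{Ext}_\sigma$ and a binary predicate $=_\sigma$. Its axioms are those of $\mathsf{HA}^\omega$, induction for all formulas of the extended language, and for all $\sigma,\tau$: $x=_0y\leftrightarrow x\equiv_0y$; $\forall x:0\,\mathrm{Ext}_0(x)$; $x=_{\sigma\times\tau}y\leftrightarrow(\mathsf{fst}\,x=_\sigma\mathsf{fst}\,y\wedge\mathsf{snd}\,x=_\tau\mathsf{snd}\,y)$; $\mathrm{Ext}_{\sigma\times\tau}(x)\leftrightarrow(\mathrm{Ext}_\sigma(\mathsf{fst}\,x)\wedge\mathrm{Ext}_\tau(\mathsf{snd}\,x))$; $f=_{\sigma\to\tau}g\leftrightarrow\forall x:\sigma(\mathrm{Ext}_\sigma(x)\to fx=_\tau gx)$; $\mathrm{Ext}_{\sigma\to\tau}(f)\to\mathrm{Ext}_\sigma(x)\to\mathrm{Ext}_\tau(fx)$; $x\equiv_\sigma y\to\mathrm{Ext}_\sigma(x)\to\mathrm{Ext}_\sigma(y)$; $\mathrm{Ext}(c)$ for each constant $c$. $\mathsf{HE}\text{ - }\mathsf{HA}^\omega$ is $\mathsf{H}\text{ - }\mathsf{HA}^\omega$ plus, for all $\sigma,\tau$, the axiom $\mathrm{Ext}_{\sigma\to\tau}(f)\to\mathrm{Ext}_\sigma(x)\to\mathrm{Ext}_\sigma(y)\to x=_\sigma y\to fx=_\tau fy$. Auxiliary types and $\mathsf{HA}^\omega$-formulas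 (by induction on $\sigma$; $\mathrm{dom}_\sigma$ has a free variable $x:\sigma^+$, $\mathrm{app}_\sigma$ free variables $x,y:\sigma^+$, $z:\sigma^-$): $0^+:=0$, $0^-:=0$, $\mathrm{dom}_0(x):=\top$, $\mathrm{app}_0(x,y,z):=\neg(x\equiv_0y)$. $(\sigma\times\tau)^+:=\sigma^+\times\tau^+$, $(\sigma\times\tau)^-:=(\sigma^-\times\tau^-)\times0$, $\mathrm{dom}_{\sigma\times\tau}(x):=\mathrm{dom}_\sigma(\mathsf{fst}\,x)\wedge\mathrm{dom}_\tau(\mathsf{snd}\,x)$, $\mathrm{app}_{\sigma\times\tau}(x,y,z):=(\mathsf{snd}\,z\equiv_00\to\mathrm{app}_\sigma(\mathsf{fst}\,x,\mathsf{fst}\,y,\mathsf{fst}(\mathsf{fst}\,z)))\wedge(\neg(\mathsf{snd}\,z\equiv_00)\to\mathrm{app}_\tau(\mathsf{snd}\,x,\mathsf{snd}\,y,\mathsf{snd}(\mathsf{fst}\,z)))$. $(\sigma\to\tau)^+:=(\sigma^+\to\tau^+)\times(\sigma^+\to\sigma^+\to\tau^-\to\sigma^-)$, $(\sigma\to\tau)^-:=\sigma^+\times\tau^-$; for $s:(\sigma\to\tau)^+$, $t:\sigma^+$ write $s*t:=(\mathsf{fst}\,s)t:\tau^+$ ($*$ associates to the left); $\mathrm{dom}_{\sigma\to\tau}(x):=\forall u:\sigma^+(\mathrm{dom}_\sigma(u)\to\mathrm{dom}_\tau(x*u))\wedge\forall u,v:\sigma^+\forall w:\tau^-(\mathrm{dom}_\sigma(u)\to\mathrm{dom}_\sigma(v)\to\mathrm{app}_\tau(x*u,x*v,w)\to\mathrm{app}_\sigma(u,v,(\mathsf{snd}\,x)uvw))$;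 $\mathrm{app}_{\sigma\to\tau}(x,y,z):=\mathrm{dom}_\sigma(\mathsf{fst}\,z)\wedge\mathrm{app}_\tau(x*(\mathsf{fst}\,z),y*(\mathsf{fst}\,z),\mathsf{snd}\,z)$. -}

module Defs where

open import Data.Nat using (ℕ; zero; suc; _⊔_)
import Data.Nat as N
open import Data.Bool using (Bool; true; false; _∧_; _∨_; not; if_then_else_)
open import Relation.Nullary using (Dec; yes; no)
open import Relation.Nullary.Decidable using (⌊_⌋)
open import Relation.Binary.PropositionalEquality using (_≡_; refl)
open import Data.Product using (_×_)

infixr 7 _⇒_
infixr 8 _⊗_

data Ty : Set where
  o   : Ty
  _⊗_ : Ty → Ty → Ty
  _⇒_ : Ty → Ty → Ty

_≟T_ : (σ τ : Ty) → Dec (σ ≡ τ)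
o ≟T o = yes refl
o ≟T (_ ⊗ _) = no λ ()
o ≟T (_ ⇒ _) = no λ ()
(_ ⊗ _) ≟T o = no λ ()
(σ ⊗ τ) ≟T (σ' ⊗ τ') with σ ≟T σ' | τ ≟T τ'
... | yes refl | yes refl = yes refl
... | no p | _ = no λ { refl → p refl }
... | yes _ | no q = no λ { refl → q refl }
(_ ⊗ _) ≟T (_ ⇒ _) = no λ ()
(_ ⇒ _) ≟T o = no λ ()
(_ ⇒ _) ≟T (_ ⊗ _) = no λ ()
(σ ⇒ τ) ≟T (σ' ⇒ τ') with σ ≟T σ' | τ ≟T τ'
... | yes refl | yes refl = yes refl
... | no p | _ = no λ { refl → p refl }
... | yes _ | no q = no λ { refl → q refl }

-- Constants and terms of HA^ω.  Variables of type σ are  var {σ} n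
-- (n : ℕ); the variable is identified by the pair (σ , n).

data Const : Ty → Set where
  kc    : (ρ σ : Ty) → Const (ρ ⇒ σ ⇒ ρ)
  sc    : (ρ σ τ : Ty) → Const ((ρ ⇒ σ ⇒ τ) ⇒ (ρ ⇒ σ) ⇒ (ρ ⇒ τ))
  pairc : (σ τ : Ty) → Const (σ ⇒ τ ⇒ σ ⊗ τ)
  fstc  : (σ τ : Ty) → Const (σ ⊗ τ ⇒ σ)
  sndc  : (σ τ : Ty) → Const (σ ⊗ τ ⇒ τ)
  zeroc : Const o
  succ  : Const (o ⇒ o)
  recc  : (σ : Ty) → Const (σ ⇒ (o ⇒ σ ⇒ σ) ⇒ o ⇒ σ)

infixl 9 _·_

data Tm : Ty → Set where
  var : ∀ {σ} → ℕ → Tm σ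
  con : ∀ {σ} → Const σ → Tm σ
  _·_ : ∀ {σ τ} → Tm (σ ⇒ τ) → Tm σ → Tm τ

fstT : ∀ {σ τ} → Tm (σ ⊗ τ) → Tm σ
fstT {σ} {τ} x = con (fstc σ τ) · x

sndT : ∀ {σ τ} → Tm (σ ⊗ τ) → Tm τ
sndT {σ} {τ} x = con (sndc σ τ) · x

eqV : Ty → ℕ → Ty → ℕ → Bool
eqV σ m τ n = ⌊ σ ≟T τ ⌋ ∧ ⌊ m N.≟ n ⌋

occursTm : ∀ {σ} → Ty → ℕ → Tm σ → Bool
occursTm τ n (var {σ} m) = eqV σ m τ n
occursTm τ n (con c) = false
occursTm τ n (s · t) = occursTm τ n s ∨ occursTm τ n t

closed : ∀ {σ} → Tm σ → Bool
closed (var _) = false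
closed (con _) = true
closed (s · t) = closed s ∧ closed t

Closed : ∀ {σ} → Tm σ → Set
Closed t = closed t ≡ true

fresh : ∀ {σ} → Tm σ → ℕ
fresh (var m) = suc m
fresh (con _) = 0
fresh (s · t) = fresh s ⊔ fresh t

subTm : ∀ {σ τ} → ℕ → Tm τ → Tm σ → Tm σ
subTm {σ} {τ} n t (var m) with τ ≟T σ | m N.≟ n
... | yes refl | yes _ = t
... | _ | _ = var m
subTm n t (con c) = con c
subTm n t (r · s) = subTm n t r · subTm n t s

data Lang : Set where
  HAω Hω : Lang

infix  5 _≐_ _==_
infixr 4 _∧ᶠ_
infixr 3 _∨ᶠ_
infixr 2 _⊃_

data Fm : Lang → Set where
  ⊥ᶠ   : ∀ {L} → Fm L
  _≐_  : ∀ {L σ} → Tm σ → Tm σ → Fm L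
  Ext  : ∀ {σ} → Tm σ → Fm Hω
  _==_ : ∀ {σ} → Tm σ → Tm σ → Fm Hω
  _∧ᶠ_ _∨ᶠ_ _⊃_ : ∀ {L} → Fm L → Fm L → Fm L
  ∀ᶠ ∃ᶠ : ∀ {L} → (σ : Ty) → ℕ → Fm L → Fm L    -- ∀x:σ / ∃x:σ with x = (σ , n)

¬ᶠ_ : ∀ {L} → Fm L → Fm L
¬ᶠ φ = φ ⊃ ⊥ᶠ

⊤ᶠ : ∀ {L} → Fm L
⊤ᶠ = ⊥ᶠ ⊃ ⊥ᶠ

_⇔_ : ∀ {L} → Fm L → Fm L → Fm L
φ ⇔ ψ = (φ ⊃ ψ) ∧ᶠ (ψ ⊃ φ)

freeIn : ∀ {L} → Ty → ℕ → Fm L → Bool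
freeIn τ n ⊥ᶠ = false
freeIn τ n (s ≐ t) = occursTm τ n s ∨ occursTm τ n t
freeIn τ n (Ext t) = occursTm τ n t
freeIn τ n (s == t) = occursTm τ n s ∨ occursTm τ n t
freeIn τ n (φ ∧ᶠ ψ) = freeIn τ n φ ∨ freeIn τ n ψ
freeIn τ n (φ ∨ᶠ ψ) = freeIn τ n φ ∨ freeIn τ n ψ
freeIn τ n (φ ⊃ ψ) = freeIn τ n φ ∨ freeIn τ n ψ
freeIn τ n (∀ᶠ σ m φ) = if eqV σ m τ n then false else freeIn τ n φ
freeIn τ n (∃ᶠ σ m φ) = if eqV σ m τ n then false else freeIn τ n φ

subF : ∀ {L τ} → ℕ → Tm τ → Fm L → Fm L
subF n t ⊥ᶠ = ⊥ᶠ
subF n t (r ≐ s) = subTm n t r ≐ subTm n t s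
subF n t (Ext s) = Ext (subTm n t s)
subF n t (r == s) = subTm n t r == subTm n t s
subF n t (φ ∧ᶠ ψ) = subF n t φ ∧ᶠ subF n t ψ
subF n t (φ ∨ᶠ ψ) = subF n t φ ∨ᶠ subF n t ψ
subF n t (φ ⊃ ψ) = subF n t φ ⊃ subF n t ψ
subF {τ = τ} n t (∀ᶠ σ m φ) = if eqV σ m τ n then ∀ᶠ σ m φ else ∀ᶠ σ m (subF n t φ)
subF {τ = τ} n t (∃ᶠ σ m φ) = if eqV σ m τ n then ∃ᶠ σ m φ else ∃ᶠ σ m (subF n t φ)

freeFor : ∀ {L τ} → ℕ → Tm τ → Fm L → Bool
freeFor n t ⊥ᶠ = true
freeFor n t (_ ≐ _) = true
freeFor n t (Ext _) = true
freeFor n t (_ == _) = true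
freeFor n t (φ ∧ᶠ ψ) = freeFor n t φ ∧ freeFor n t ψ
freeFor n t (φ ∨ᶠ ψ) = freeFor n t φ ∧ freeFor n t ψ
freeFor n t (φ ⊃ ψ) = freeFor n t φ ∧ freeFor n t ψ
freeFor {τ = τ} n t (∀ᶠ σ m φ) =
  if eqV σ m τ n then true
  else (not (freeIn τ n φ) ∨ (not (occursTm σ m t) ∧ freeFor n t φ))
freeFor {τ = τ} n t (∃ᶠ σ m φ) =
  if eqV σ m τ n then true
  else (not (freeIn τ n φ) ∨ (not (occursTm σ m t) ∧ freeFor n t φ))

infix 1 _⊢_

data _⊢_ {L : Lang} (Ax : Fm L → Set) : Fm L → Set where
  ax   : ∀ {φ} → Ax φ → Ax ⊢ φ
  mp   : ∀ {φ ψ} → Ax ⊢ φ ⊃ ψ → Ax ⊢ φ → Ax ⊢ ψ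
  K    : ∀ {φ ψ} → Ax ⊢ φ ⊃ ψ ⊃ φ
  S    : ∀ {φ ψ χ} → Ax ⊢ (φ ⊃ ψ ⊃ χ) ⊃ (φ ⊃ ψ) ⊃ φ ⊃ χ
  ∧I   : ∀ {φ ψ} → Ax ⊢ φ ⊃ ψ ⊃ φ ∧ᶠ ψ
  ∧E₁  : ∀ {φ ψ} → Ax ⊢ φ ∧ᶠ ψ ⊃ φ
  ∧E₂  : ∀ {φ ψ} → Ax ⊢ φ ∧ᶠ ψ ⊃ ψ
  ∨I₁  : ∀ {φ ψ} → Ax ⊢ φ ⊃ φ ∨ᶠ ψ
  ∨I₂  : ∀ {φ ψ} → Ax ⊢ ψ ⊃ φ ∨ᶠ ψ
  ∨E   : ∀ {φ ψ χ} → Ax ⊢ (φ ⊃ χ) ⊃ (ψ ⊃ χ) ⊃ φ ∨ᶠ ψ ⊃ χ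
  efq  : ∀ {φ} → Ax ⊢ ⊥ᶠ ⊃ φ
  ∀E   : ∀ {σ} n (t : Tm σ) φ → freeFor n t φ ≡ true →
         Ax ⊢ ∀ᶠ σ n φ ⊃ subF n t φ
  ∃I   : ∀ {σ} n (t : Tm σ) φ → freeFor n t φ ≡ true →
         Ax ⊢ subF n t φ ⊃ ∃ᶠ σ n φ
  ∀I   : ∀ {σ} n {φ ψ} → freeIn σ n ψ ≡ false →
         Ax ⊢ ψ ⊃ φ → Ax ⊢ ψ ⊃ ∀ᶠ σ n φ
  ∃E   : ∀ {σ} n {φ ψ} → freeIn σ n ψ ≡ false →
         Ax ⊢ φ ⊃ ψ → Ax ⊢ ∃ᶠ σ n φ ⊃ ψ

data BaseAx (L : Lang) : Fm L → Set where
  ≐-refl  : ∀ {σ} (t : Tm σ) → BaseAx L (t ≐ t)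
  ≐-sym   : ∀ {σ} (s t : Tm σ) → BaseAx L (s ≐ t ⊃ t ≐ s)
  ≐-trans : ∀ {σ} (r s t : Tm σ) → BaseAx L (r ≐ s ⊃ s ≐ t ⊃ r ≐ t)
  ≐-app   : ∀ {σ τ} (f f' : Tm (σ ⇒ τ)) (x x' : Tm σ) →
            BaseAx L (f ≐ f' ⊃ x ≐ x' ⊃ f · x ≐ f' · x')
  k-ax    : ∀ {ρ σ} (x : Tm ρ) (y : Tm σ) → BaseAx L (con (kc ρ σ) · x · y ≐ x)
  s-ax    : ∀ {ρ σ τ} (x : Tm (ρ ⇒ σ ⇒ τ)) (y : Tm (ρ ⇒ σ)) (z : Tm ρ) →
            BaseAx L (con (sc ρ σ τ) · x · y · z ≐ x · z · (y · z))
  fst-ax  : ∀ {σ τ} (x : Tm σ) (y : Tm τ) → BaseAx L (fstT (con (pairc σ τ) · x · y) ≐ x)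
  snd-ax  : ∀ {σ τ} (x : Tm σ) (y : Tm τ) → BaseAx L (sndT (con (pairc σ τ) · x · y) ≐ y)
  R0-ax   : ∀ {σ} (x : Tm σ) (y : Tm (o ⇒ σ ⇒ σ)) →
            BaseAx L (con (recc σ) · x · y · con zeroc ≐ x)
  RS-ax   : ∀ {σ} (x : Tm σ) (y : Tm (o ⇒ σ ⇒ σ)) (m : Tm o) →
            BaseAx L (con (recc σ) · x · y · (con succ · m) ≐ y · m · (con (recc σ) · x · y · m))
  S-inj   : (x y : Tm o) → BaseAx L (con succ · x ≐ con succ · y ⊃ x ≐ y)
  S-ne0   : (x : Tm o) → BaseAx L (¬ᶠ (con succ · x ≐ con zeroc))
  ind     : (n : ℕ) (φ : Fm L) →
            BaseAx L (subF n (con {o} zeroc) φ ⊃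
                      ∀ᶠ o n (φ ⊃ subF n (con succ · var {o} n) φ) ⊃
                      ∀ᶠ o n φ)

HA : Fm HAω → Set
HA = BaseAx HAω

data HAx : Fm Hω → Set where
  eq0     : (x y : Tm o) → HAx ((x == y) ⇔ (x ≐ y))
  ext0    : (n : ℕ) → HAx (∀ᶠ o n (Ext (var {o} n)))
  eq⊗     : ∀ {σ τ} (x y : Tm (σ ⊗ τ)) →
            HAx ((x == y) ⇔ ((fstT x == fstT y) ∧ᶠ (sndT x == sndT y)))
  ext⊗    : ∀ {σ τ} (x : Tm (σ ⊗ τ)) →
            HAx (Ext x ⇔ (Ext (fstT x) ∧ᶠ Ext (sndT x)))
  eq⇒     : ∀ {σ τ} (f g : Tm (σ ⇒ τ)) (n : ℕ) →
            occursTm σ n f ≡ false → occursTm σ n g ≡ false →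
            HAx ((f == g) ⇔ ∀ᶠ σ n (Ext (var {σ} n) ⊃ f · var n == g · var n))
  extApp  : ∀ {σ τ} (f : Tm (σ ⇒ τ)) (x : Tm σ) → HAx (Ext f ⊃ Ext x ⊃ Ext (f · x))
  ext≐    : ∀ {σ} (x y : Tm σ) → HAx (x ≐ y ⊃ Ext x ⊃ Ext y)
  extCon  : ∀ {σ} (c : Const σ) → HAx (Ext (con c))

data H-HA : Fm Hω → Set where
  base : ∀ {φ} → BaseAx Hω φ → H-HA φ
  hax  : ∀ {φ} → HAx φ → H-HA φ

data HE-HA : Fm Hω → Set where
  h-ha : ∀ {φ} → H-HA φ → HE-HA φ
  ext  : ∀ {σ τ} (f : Tm (σ ⇒ τ)) (x y : Tm σ) →
         HE-HA (Ext f ⊃ Ext x ⊃ Ext y ⊃ x == y ⊃ f · x == f · y)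

_⁺ : Ty → Ty
_⁻ : Ty → Ty
o ⁺ = o
(σ ⊗ τ) ⁺ = σ ⁺ ⊗ τ ⁺
(σ ⇒ τ) ⁺ = (σ ⁺ ⇒ τ ⁺) ⊗ (σ ⁺ ⇒ σ ⁺ ⇒ τ ⁻ ⇒ σ ⁻)
o ⁻ = o
(σ ⊗ τ) ⁻ = (σ ⁻ ⊗ τ ⁻) ⊗ o
(σ ⇒ τ) ⁻ = σ ⁺ ⊗ τ ⁻

infixl 8 _*_
_*_ : ∀ {σ τ} → Tm ((σ ⇒ τ) ⁺) → Tm (σ ⁺) → Tm (τ ⁺)
s * t = fstT s · t

-- dom_σ(x) and app_σ(x,y,z), given as functions of the terms substituted
-- for the free variables x, y, z; bound variables are chosen fresh
-- (indices above every index occurring in the arguments).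
dom : (σ : Ty) → Tm (σ ⁺) → Fm HAω
app : (σ : Ty) → Tm (σ ⁺) → Tm (σ ⁺) → Tm (σ ⁻) → Fm HAω
dom o x = ⊤ᶠ
dom (σ ⊗ τ) x = dom σ (fstT x) ∧ᶠ dom τ (sndT x)
dom (σ ⇒ τ) x =
  ∀ᶠ (σ ⁺) n (dom σ u ⊃ dom τ (x * u)) ∧ᶠ
  ∀ᶠ (σ ⁺) n (∀ᶠ (σ ⁺) (suc n) (∀ᶠ (τ ⁻) (suc (suc n))
     (dom σ u ⊃ dom σ v ⊃ app τ (x * u) (x * v) w ⊃
      app σ u v (sndT x · u · v · w))))
  where
    n = fresh x
    u : Tm (σ ⁺)
    u = var n
    v : Tm (σ ⁺)
    v = var (suc n)
    w : Tm (τ ⁻)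
    w = var (suc (suc n))
app o x y z = ¬ᶠ (x ≐ y)
app (σ ⊗ τ) x y z =
  (sndT z ≐ con zeroc ⊃ app σ (fstT x) (fstT y) (fstT (fstT z))) ∧ᶠ
  (¬ᶠ (sndT z ≐ con zeroc) ⊃ app τ (sndT x) (sndT y) (sndT (fstT z)))
app (σ ⇒ τ) x y z = dom σ (fstT z) ∧ᶠ app τ (x * fstT z) (y * fstT z) (sndT z)

-- The α-translation, relative to an assignment cα of terms to constants
-- and an assignment α of variables: variable (σ , n) ↦ (σ ⁺ , α σ n).

ConstAssignment : Set
ConstAssignment = (σ : Ty) → Const σ → Tm (σ ⁺)

VarAssignment : Set
VarAssignment = Ty → ℕ → ℕ

InjectiveVarAssignment : VarAssignment → Set
InjectiveVarAssignment α =
  ∀ σ τ m n → σ ⁺ ≡ τ ⁺ → α σ m ≡ α τ n → (σ ≡ τ) × (m ≡ n)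

trTm : ConstAssignment → VarAssignment → ∀ {σ} → Tm σ → Tm (σ ⁺)
trTm cα α (var {σ} n) = var (α σ n)
trTm cα α (con {σ} c) = cα σ c
trTm cα α (s · t) = trTm cα α s * trTm cα α t

trFm : ConstAssignment → VarAssignment → Fm Hω → Fm HAω
trFm cα α ⊥ᶠ = ⊥ᶠ
trFm cα α (s ≐ t) = trTm cα α s ≐ trTm cα α t
trFm cα α (Ext {σ} t) = dom σ (trTm cα α t)
trFm cα α (_==_ {σ} s t) =
  ¬ᶠ (∃ᶠ (σ ⁻) n (app σ s' t' (var n)))
  where
    s' = trTm cα α s
    t' = trTm cα α t
    n = fresh s' ⊔ fresh t'
trFm cα α (φ ∧ᶠ ψ) = trFm cα α φ ∧ᶠ trFm cα α ψ
trFm cα α (φ ∨ᶠ ψ) = trFm cα α φ ∨ᶠ trFm cα α ψ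
trFm cα α (φ ⊃ ψ) = trFm cα α φ ⊃ trFm cα α ψ
trFm cα α (∀ᶠ σ n φ) = ∀ᶠ (σ ⁺) (α σ n) (trFm cα α φ)
trFm cα α (∃ᶠ σ n φ) = ∃ᶠ (σ ⁺) (α σ n) (trFm cα α φ)

module Submission where

-- Dialectica-style extensionality: an element of (σ ⇒ τ)⁺ is a function together with a
-- functional turning evidence that two values are apart into evidence that the arguments
-- are apart, so that equality (the absence of apartness evidence) is preserved by fiat.
-- What has to be shown is that every constant carries such a functional.  For s and R two
-- arguments vary at once along a chain of values, and one must decide which link of the
-- chain is broken; this is possible since evidence for app_σ x y z only leads to comparing
-- two natural numbers, so that app_σ is cotransitive and a closed term dif_σ decides which
-- alternative holds.
--
-- dom and app choose their bound names from their arguments, hence do not commute with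
-- substitution.  Formulas are therefore never substituted into: ∀ a (a ≐ t ⊃ ψ) is
-- instantiated instead (letEq), combined with congruence of the formulas in their
-- term arguments.

open import Defs
open import Data.Bool using (false; true; _∧_; _∨_; not; if_then_else_)
open import Data.Bool.Properties using (∨-conicalˡ; ∨-conicalʳ; ∧-conicalˡ; ∧-conicalʳ)
open import Data.List using (List; []; _∷_; _++_; length)
open import Data.List.Membership.Propositional using (_∈_)
open import Data.List.Relation.Unary.All using (All; []; _∷_; lookup)
open import Data.List.Relation.Unary.All.Properties using (++⁺)
open import Data.List.Relation.Unary.Any using (here; there)
open import Data.Nat using (ℕ; suc; _⊔_; _≤_; _<_; _+_; s≤s; z≤n)
import Data.Nat as N
open import Data.Nat.Properties
  using (≤-refl; ≤-trans; <-irrefl; <-≤-trans; <⇒≤; <⇒≢; n≤1+n; 1+n≢n; +-suc; m≤m+n;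
         m≤m⊔n; m≤n⊔m; m⊔n≤o⇒m≤o; m⊔n≤o⇒n≤o)
open import Data.Product using (Σ; _×_; _,_)
open import Data.Unit using (⊤; tt)
open import Relation.Binary.PropositionalEquality using (_≡_; _≢_; refl; sym; trans; cong; cong₂; subst)
open import Relation.Nullary using (yes; no; contradiction)

-- The reflecting part of a constant must be one closed term. A derivable disjunction saying which
-- link of a chain is broken is therefore not enough: the choice has to be computed, so `dif`
-- returns a number and a conditional joins the branches. The intermediate point is placed so that
-- each link changes one thing only. Either the function changes at a fixed argument, and then the
-- failure is itself evidence at function type; or the argument of a fixed function changes, and
-- then its reflecting part applies. For the recursor the second kind of link leads to the previous
-- stage, so evidence travels down the recursion. Equality becomes a negated existential, so
-- evidence has to be transformed but never found. The price is paid at type 0, where the absence of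
-- evidence is only a double negation of the equation; decidability of equality of numbers removes
-- it.

-- Variables, substitution and freshness

eqV-refl : ∀ σ n → eqV σ n σ n ≡ true
eqV-refl σ n with σ ≟T σ | n N.≟ n
... | yes _ | yes _ = refl
... | yes _ | no q  = contradiction refl q
... | no p  | _     = contradiction refl p

eqV-sound : ∀ σ m τ n → eqV σ m τ n ≡ true → σ ≡ τ × m ≡ n
eqV-sound σ m τ n e with σ ≟T τ | m N.≟ n
... | yes p | yes q = p , q

eqV-false : ∀ {σ m τ n} → (σ ≡ τ → m ≢ n) → eqV σ m τ n ≡ false
eqV-false {σ} {m} {τ} {n} d with σ ≟T τ | m N.≟ n
... | yes p | yes q = contradiction q (d p)
... | yes p | no _  = refl
... | no _  | _     = refl

eqV-distinct : ∀ σ m τ n → eqV σ m τ n ≡ false → σ ≡ τ → m ≢ n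
eqV-distinct σ m _ _ e refl refl with () ← trans (sym e) (eqV-refl σ m)

eqV-sym : ∀ σ m τ n → eqV σ m τ n ≡ false → eqV τ n σ m ≡ false
eqV-sym σ m τ n e = eqV-false λ p q → eqV-distinct σ m τ n e (sym p) (sym q)

∨-false : ∀ {a b} → a ≡ false → b ≡ false → a ∨ b ≡ false
∨-false refl refl = refl

∧-true : ∀ {a b} → a ≡ true → b ≡ true → a ∧ b ≡ true
∧-true refl refl = refl

if-false : ∀ b {x} → (b ≡ false → x ≡ false) → (if b then false else x) ≡ false
if-false true  h = refl
if-false false h = h refl

if-true : ∀ b {x} → (b ≡ false → x ≡ true) → (if b then true else x) ≡ true
if-true true  h = refl
if-true false h = h refl

fresh-∉ : ∀ {σ} (t : Tm σ) {τ n} → fresh t ≤ n → occursTm τ n t ≡ false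
fresh-∉ (var m) le = eqV-false λ _ e → <-irrefl e le
fresh-∉ (con c) le = refl
fresh-∉ (s · t) le = ∨-false (fresh-∉ s (m⊔n≤o⇒m≤o (fresh s) _ le))
                             (fresh-∉ t (m⊔n≤o⇒n≤o (fresh s) _ le))

closed-∉ : ∀ {σ} (t : Tm σ) {τ n} → Closed t → occursTm τ n t ≡ false
closed-∉ (con c) _ = refl
closed-∉ (s · t) c = ∨-false (closed-∉ s (∧-conicalˡ _ _ c)) (closed-∉ t (∧-conicalʳ _ _ c))

subTm-∉ : ∀ {σ τ n} {t : Tm τ} (s : Tm σ) → occursTm τ n s ≡ false → subTm n t s ≡ s
subTm-∉ {σ} {τ} {n} (var m) e with τ ≟T σ | m N.≟ n | eqV-distinct σ m τ n e
... | yes refl | yes refl | d = contradiction refl (d refl)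
... | yes refl | no _     | _ = refl
... | no _     | _        | _ = refl
subTm-∉ (con c) e = refl
subTm-∉ (r · s) e = cong₂ _·_ (subTm-∉ r (∨-conicalˡ _ _ e)) (subTm-∉ s (∨-conicalʳ _ _ e))

subTm-var : ∀ {τ} n (t : Tm τ) → subTm n t (var {τ} n) ≡ t
subTm-var {τ} n t with τ ≟T τ | n N.≟ n
... | yes refl | yes _ = refl
... | yes _    | no q  = contradiction refl q
... | no p     | _     = contradiction refl p

subTm-self : ∀ {σ τ} n (s : Tm σ) → subTm n (var {τ} n) s ≡ s
subTm-self {σ} {τ} n (var m) with τ ≟T σ | m N.≟ n
... | yes refl | yes refl = refl
... | yes refl | no _     = refl
... | no _     | _        = refl
subTm-self n (con c) = refl
subTm-self n (r · s) = cong₂ _·_ (subTm-self n r) (subTm-self n s)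

subTm-free : ∀ {σ τ ρ n k} {t : Tm τ} (s : Tm σ) →
             (eqV ρ k τ n ≡ false → occursTm ρ k s ≡ false) →
             occursTm ρ k t ≡ false → occursTm ρ k (subTm n t s) ≡ false
subTm-free {σ} {τ} {ρ} {n} {k} (var m) h ht with τ ≟T σ | m N.≟ n
... | yes refl | yes refl = ht
... | yes refl | no q     = eqV-false {σ} {m} {ρ} {k} λ { refl refl → eqV-distinct σ m σ m (h (eqV-false λ _ → q)) refl refl }
... | no p     | _        = eqV-false {σ} {m} {ρ} {k} λ { refl refl → eqV-distinct σ m σ m (h (eqV-false λ e → contradiction (sym e) p)) refl refl }
subTm-free (con c) h ht = refl
subTm-free (r · s) h ht = ∨-false (subTm-free r (λ e → ∨-conicalˡ _ _ (h e)) ht)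
                                  (subTm-free s (λ e → ∨-conicalʳ _ _ (h e)) ht)

if-idem : ∀ {A : Set} b {x y : A} → (b ≡ false → y ≡ x) → (if b then x else y) ≡ x
if-idem true  e = refl
if-idem false e = e refl

if-false⁻¹ : ∀ {b x} → (if b then false else x) ≡ false → b ≡ false → x ≡ false
if-false⁻¹ e refl = e

subF-∉ : ∀ {L τ n} {t : Tm τ} (φ : Fm L) → freeIn τ n φ ≡ false → subF n t φ ≡ φ
subF-∉ ⊥ᶠ e = refl
subF-∉ (r ≐ s) e = cong₂ _≐_ (subTm-∉ r (∨-conicalˡ _ _ e)) (subTm-∉ s (∨-conicalʳ _ _ e))
subF-∉ (Ext s) e = cong Ext (subTm-∉ s e)
subF-∉ (r == s) e = cong₂ _==_ (subTm-∉ r (∨-conicalˡ _ _ e)) (subTm-∉ s (∨-conicalʳ _ _ e))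
subF-∉ (φ ∧ᶠ ψ) e = cong₂ _∧ᶠ_ (subF-∉ φ (∨-conicalˡ _ _ e)) (subF-∉ ψ (∨-conicalʳ _ _ e))
subF-∉ (φ ∨ᶠ ψ) e = cong₂ _∨ᶠ_ (subF-∉ φ (∨-conicalˡ _ _ e)) (subF-∉ ψ (∨-conicalʳ _ _ e))
subF-∉ (φ ⊃ ψ) e = cong₂ _⊃_ (subF-∉ φ (∨-conicalˡ _ _ e)) (subF-∉ ψ (∨-conicalʳ _ _ e))
subF-∉ {τ = τ} {n} (∀ᶠ σ m φ) e = if-idem (eqV σ m τ n) λ b → cong (∀ᶠ σ m) (subF-∉ φ (if-false⁻¹ e b))
subF-∉ {τ = τ} {n} (∃ᶠ σ m φ) e = if-idem (eqV σ m τ n) λ b → cong (∃ᶠ σ m) (subF-∉ φ (if-false⁻¹ e b))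

subF-self : ∀ {L τ} n (φ : Fm L) → subF n (var {τ} n) φ ≡ φ
subF-self n ⊥ᶠ = refl
subF-self n (r ≐ s) = cong₂ _≐_ (subTm-self n r) (subTm-self n s)
subF-self n (Ext s) = cong Ext (subTm-self n s)
subF-self n (r == s) = cong₂ _==_ (subTm-self n r) (subTm-self n s)
subF-self n (φ ∧ᶠ ψ) = cong₂ _∧ᶠ_ (subF-self n φ) (subF-self n ψ)
subF-self n (φ ∨ᶠ ψ) = cong₂ _∨ᶠ_ (subF-self n φ) (subF-self n ψ)
subF-self n (φ ⊃ ψ) = cong₂ _⊃_ (subF-self n φ) (subF-self n ψ)
subF-self {τ = τ} n (∀ᶠ σ m φ) = if-idem (eqV σ m τ n) λ _ → cong (∀ᶠ σ m) (subF-self n φ)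
subF-self {τ = τ} n (∃ᶠ σ m φ) = if-idem (eqV σ m τ n) λ _ → cong (∃ᶠ σ m) (subF-self n φ)

-- The conditional hypothesis merges two facts. For the replaced variable itself it is vacuous: that
-- variable disappears unless `t` brings it back. For any other variable it says that substitution
-- adds only the variables of `t`.
subF-free : ∀ {L τ ρ n k} {t : Tm τ} (φ : Fm L) →
            (eqV ρ k τ n ≡ false → freeIn ρ k φ ≡ false) →
            occursTm ρ k t ≡ false → freeIn ρ k (subF n t φ) ≡ false
subF-free-quant : ∀ {L τ ρ n k} {t : Tm τ} σ m (φ : Fm L) →
            (eqV ρ k τ n ≡ false → (if eqV σ m ρ k then false else freeIn ρ k φ) ≡ false) →
            occursTm ρ k t ≡ false →
            (if eqV σ m ρ k then false else freeIn ρ k (subF n t φ)) ≡ false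
subF-free-quant {ρ = ρ} {k = k} σ m φ h ht =
  if-false (eqV σ m ρ k) λ b → subF-free φ (λ e → if-false⁻¹ (h e) b) ht
subF-free-stop : ∀ {L τ ρ n k} σ m (φ : Fm L) → eqV σ m τ n ≡ true →
            (eqV ρ k τ n ≡ false → (if eqV σ m ρ k then false else freeIn ρ k φ) ≡ false) →
            (if eqV σ m ρ k then false else freeIn ρ k φ) ≡ false
subF-free-stop {τ = τ} {ρ} {n} {k} σ m φ b h with eqV-sound σ m τ n b
... | refl , refl = if-false (eqV σ m ρ k) λ b′ → if-false⁻¹ (h (eqV-sym σ m ρ k b′)) b′
subF-free ⊥ᶠ h ht = refl
subF-free (r ≐ s) h ht = ∨-false (subTm-free r (λ e → ∨-conicalˡ _ _ (h e)) ht)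
                                 (subTm-free s (λ e → ∨-conicalʳ _ _ (h e)) ht)
subF-free (Ext s) h ht = subTm-free s h ht
subF-free (r == s) h ht = ∨-false (subTm-free r (λ e → ∨-conicalˡ _ _ (h e)) ht)
                                  (subTm-free s (λ e → ∨-conicalʳ _ _ (h e)) ht)
subF-free (φ ∧ᶠ ψ) h ht = ∨-false (subF-free φ (λ e → ∨-conicalˡ _ _ (h e)) ht)
                                  (subF-free ψ (λ e → ∨-conicalʳ _ _ (h e)) ht)
subF-free (φ ∨ᶠ ψ) h ht = ∨-false (subF-free φ (λ e → ∨-conicalˡ _ _ (h e)) ht)
                                  (subF-free ψ (λ e → ∨-conicalʳ _ _ (h e)) ht)
subF-free (φ ⊃ ψ) h ht = ∨-false (subF-free φ (λ e → ∨-conicalˡ _ _ (h e)) ht)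
                                 (subF-free ψ (λ e → ∨-conicalʳ _ _ (h e)) ht)
subF-free {τ = τ} {n = n} (∀ᶠ σ m φ) h ht with eqV σ m τ n in b
... | true  = subF-free-stop σ m φ b h
... | false = subF-free-quant σ m φ h ht
subF-free {τ = τ} {n = n} (∃ᶠ σ m φ) h ht with eqV σ m τ n in b
... | true  = subF-free-stop σ m φ b h
... | false = subF-free-quant σ m φ h ht

freeFor-∉ : ∀ {L τ n} {t : Tm τ} (φ : Fm L) → freeIn τ n φ ≡ false → freeFor n t φ ≡ true
freeFor-∉ ⊥ᶠ e = refl
freeFor-∉ (r ≐ s) e = refl
freeFor-∉ (Ext s) e = refl
freeFor-∉ (r == s) e = refl
freeFor-∉ (φ ∧ᶠ ψ) e = ∧-true (freeFor-∉ φ (∨-conicalˡ _ _ e)) (freeFor-∉ ψ (∨-conicalʳ _ _ e))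
freeFor-∉ (φ ∨ᶠ ψ) e = ∧-true (freeFor-∉ φ (∨-conicalˡ _ _ e)) (freeFor-∉ ψ (∨-conicalʳ _ _ e))
freeFor-∉ (φ ⊃ ψ) e = ∧-true (freeFor-∉ φ (∨-conicalˡ _ _ e)) (freeFor-∉ ψ (∨-conicalʳ _ _ e))
freeFor-∉ {τ = τ} {n} {t} (∀ᶠ σ m φ) e = if-true (eqV σ m τ n) λ b →
  cong (λ c → not c ∨ (not (occursTm σ m t) ∧ freeFor n t φ)) (if-false⁻¹ e b)
freeFor-∉ {τ = τ} {n} {t} (∃ᶠ σ m φ) e = if-true (eqV σ m τ n) λ b →
  cong (λ c → not c ∨ (not (occursTm σ m t) ∧ freeFor n t φ)) (if-false⁻¹ e b)

-- Strictly above every index occurring in φ, bound occurrences included.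
freshF : ∀ {L} → Fm L → ℕ
freshF ⊥ᶠ = 0
freshF (r ≐ s) = fresh r ⊔ fresh s
freshF (Ext s) = fresh s
freshF (r == s) = fresh r ⊔ fresh s
freshF (φ ∧ᶠ ψ) = freshF φ ⊔ freshF ψ
freshF (φ ∨ᶠ ψ) = freshF φ ⊔ freshF ψ
freshF (φ ⊃ ψ) = freshF φ ⊔ freshF ψ
freshF (∀ᶠ σ m φ) = suc m ⊔ freshF φ
freshF (∃ᶠ σ m φ) = suc m ⊔ freshF φ

freshF-∉ : ∀ {L} (φ : Fm L) {τ n} → freshF φ ≤ n → freeIn τ n φ ≡ false
freshF-∉ ⊥ᶠ le = refl
freshF-∉ (r ≐ s) le = ∨-false (fresh-∉ r (m⊔n≤o⇒m≤o (fresh r) _ le)) (fresh-∉ s (m⊔n≤o⇒n≤o (fresh r) _ le))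
freshF-∉ (Ext s) le = fresh-∉ s le
freshF-∉ (r == s) le = ∨-false (fresh-∉ r (m⊔n≤o⇒m≤o (fresh r) _ le)) (fresh-∉ s (m⊔n≤o⇒n≤o (fresh r) _ le))
freshF-∉ (φ ∧ᶠ ψ) le = ∨-false (freshF-∉ φ (m⊔n≤o⇒m≤o (freshF φ) _ le)) (freshF-∉ ψ (m⊔n≤o⇒n≤o (freshF φ) _ le))
freshF-∉ (φ ∨ᶠ ψ) le = ∨-false (freshF-∉ φ (m⊔n≤o⇒m≤o (freshF φ) _ le)) (freshF-∉ ψ (m⊔n≤o⇒n≤o (freshF φ) _ le))
freshF-∉ (φ ⊃ ψ) le = ∨-false (freshF-∉ φ (m⊔n≤o⇒m≤o (freshF φ) _ le)) (freshF-∉ ψ (m⊔n≤o⇒n≤o (freshF φ) _ le))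
freshF-∉ (∀ᶠ σ m φ) {τ} {n} le = if-false (eqV σ m τ n) λ _ → freshF-∉ φ (m⊔n≤o⇒n≤o (suc m) _ le)
freshF-∉ (∃ᶠ σ m φ) {τ} {n} le = if-false (eqV σ m τ n) λ _ → freshF-∉ φ (m⊔n≤o⇒n≤o (suc m) _ le)

-- A crude criterion: every variable below `freshF φ` is treated as a possible binder. The replaced
-- variable is exempt because substitution stops at its own binders, which is what admits `t`
-- containing that variable.
freeFor-avoid : ∀ {L τ n} {t : Tm τ} (φ : Fm L) →
  (∀ σ m → m < freshF φ → eqV σ m τ n ≡ false → occursTm σ m t ≡ false) →
  freeFor n t φ ≡ true
freeFor-avoid-quant : ∀ {L τ n} {t : Tm τ} {σ₀ m₀} (φ : Fm L) →
  (∀ σ m → m < suc m₀ ⊔ freshF φ → eqV σ m τ n ≡ false → occursTm σ m t ≡ false) →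
  (if eqV σ₀ m₀ τ n then true
   else (not (freeIn τ n φ) ∨ (not (occursTm σ₀ m₀ t) ∧ freeFor n t φ))) ≡ true
freeFor-avoid-quant {τ = τ} {n} {t} {σ₀} {m₀} φ h = if-true (eqV σ₀ m₀ τ n) λ b →
  ∨-trueʳ (∧-true (cong not (h σ₀ m₀ (m≤m⊔n (suc m₀) (freshF φ)) b))
                  (freeFor-avoid φ λ σ m lt → h σ m (<-≤-trans lt (m≤n⊔m (suc m₀) _))))
  where
  ∨-trueʳ : ∀ {a b} → b ≡ true → a ∨ b ≡ true
  ∨-trueʳ {false} e = e
  ∨-trueʳ {true} e = refl
freeFor-avoid ⊥ᶠ h = refl
freeFor-avoid (r ≐ s) h = refl
freeFor-avoid (Ext s) h = refl
freeFor-avoid (r == s) h = refl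
freeFor-avoid (φ ∧ᶠ ψ) h = ∧-true (freeFor-avoid φ λ σ m lt → h σ m (<-≤-trans lt (m≤m⊔n _ _)))
                                  (freeFor-avoid ψ λ σ m lt → h σ m (<-≤-trans lt (m≤n⊔m (freshF φ) _)))
freeFor-avoid (φ ∨ᶠ ψ) h = ∧-true (freeFor-avoid φ λ σ m lt → h σ m (<-≤-trans lt (m≤m⊔n _ _)))
                                  (freeFor-avoid ψ λ σ m lt → h σ m (<-≤-trans lt (m≤n⊔m (freshF φ) _)))
freeFor-avoid (φ ⊃ ψ) h = ∧-true (freeFor-avoid φ λ σ m lt → h σ m (<-≤-trans lt (m≤m⊔n _ _)))
                                 (freeFor-avoid ψ λ σ m lt → h σ m (<-≤-trans lt (m≤n⊔m (freshF φ) _)))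
freeFor-avoid (∀ᶠ σ m φ) h = freeFor-avoid-quant φ h
freeFor-avoid (∃ᶠ σ m φ) h = freeFor-avoid-quant φ h

freeFor-self : ∀ {L τ} n (φ : Fm L) → freeFor n (var {τ} n) φ ≡ true
freeFor-self {τ = τ} n φ = freeFor-avoid φ λ σ m _ → eqV-sym σ m τ n

-- Derived rules of HAω, judgments Γ ⊩ φ with a formula Γ as hypothesis

private variable
  Γ Γ′ φ ψ χ : Fm HAω
  ρ σ τ υ : Ty
  Δ Θ : List Ty

infix 1 _⊩_

_⊩_ : Fm HAω → Fm HAω → Set
Γ ⊩ φ = HA ⊢ Γ ⊃ φ

thm : HA ⊢ φ → Γ ⊩ φ
thm = mp K

ap : Γ ⊩ φ ⊃ ψ → Γ ⊩ φ → Γ ⊩ ψ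
ap f x = mp (mp S f) x

hyp : Γ ⊩ Γ
hyp {Γ} = mp (mp S K) (K {ψ = Γ})

wk : Γ′ ⊩ Γ → Γ ⊩ φ → Γ′ ⊩ φ
wk p h = ap (thm h) p

⊃I : Γ ∧ᶠ φ ⊩ ψ → Γ ⊩ φ ⊃ ψ
⊃I f = ap (ap (thm S) (thm (mp K f))) ∧I

-- Implication introduction in Kripke style, worlds being hypotheses ordered by entailment.
⊃I′ : (∀ {Γ′} → Γ′ ⊩ Γ → Γ′ ⊩ φ → Γ′ ⊩ ψ) → Γ ⊩ φ ⊃ ψ
⊃I′ f = ⊃I (f ∧E₁ ∧E₂)

closeHyp : ⊤ᶠ ⊩ φ → HA ⊢ φ
closeHyp h = mp h (hyp {⊥ᶠ})

∧I′ : Γ ⊩ φ → Γ ⊩ ψ → Γ ⊩ φ ∧ᶠ ψ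
∧I′ a b = ap (ap (thm ∧I) a) b

∧E₁′ : Γ ⊩ φ ∧ᶠ ψ → Γ ⊩ φ
∧E₁′ = ap (thm ∧E₁)

∧E₂′ : Γ ⊩ φ ∧ᶠ ψ → Γ ⊩ ψ
∧E₂′ = ap (thm ∧E₂)

exfalso : Γ ⊩ ⊥ᶠ → Γ ⊩ φ
exfalso = ap (thm efq)

≐r : {t : Tm σ} → Γ ⊩ t ≐ t
≐r = thm (ax (≐-refl _))

≐s : {s t : Tm σ} → Γ ⊩ s ≐ t → Γ ⊩ t ≐ s
≐s = ap (thm (ax (≐-sym _ _)))

infixr 4 _◾_
_◾_ : {r s t : Tm σ} → Γ ⊩ r ≐ s → Γ ⊩ s ≐ t → Γ ⊩ r ≐ t
p ◾ q = ap (ap (thm (ax (≐-trans _ _ _))) p) q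

infixl 9 _·≐_
_·≐_ : {f g : Tm (σ ⇒ τ)} {s t : Tm σ} → Γ ⊩ f ≐ g → Γ ⊩ s ≐ t → Γ ⊩ f · s ≐ g · t
p ·≐ q = ap (ap (thm (ax (≐-app _ _ _ _))) p) q

-- Instantiating a bound variable with itself is the one use of ∀E where substitution is the
-- identity on every formula, so no bound name is disturbed.
∀-own : ∀ n → Γ ⊩ ∀ᶠ σ n φ → Γ ⊩ φ
∀-own {Γ} {σ} {φ} n h =
  subst (Γ ⊩_) (subF-self n φ) (ap (thm (∀E n (var n) φ (freeFor-self n φ))) h)

∃-own : ∀ n → Γ ⊩ φ → Γ ⊩ ∃ᶠ σ n φ
∃-own {Γ} {φ} {σ} n h =
  ap (thm (∃I n (var n) φ (freeFor-self n φ))) (subst (Γ ⊩_) (sym (subF-self n φ)) h)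

-- Instantiating ∀ a (a ≐ t ⊃ ψ) at t only substitutes into an equation: this replaces
-- substitution into formulas, which would disturb the bound names chosen by dom and app.
letEq : ∀ a (t : Tm σ) → freeIn σ a Γ ≡ false → occursTm σ a t ≡ false → freeIn σ a ψ ≡ false →
        Γ ∧ᶠ (var a ≐ t) ⊩ ψ → Γ ⊩ ψ
letEq {σ} {Γ} {ψ} a t a∉Γ a∉t a∉ψ h = ap (subst (Γ ⊩_) eq inst) ≐r
  where
  body : Fm HAω
  body = var a ≐ t ⊃ ψ
  inst : Γ ⊩ subF a t body
  inst = ap (thm (∀E a t body (freeFor-∉ ψ a∉ψ))) (∀I a a∉Γ (⊃I h))
  eq : subF a t body ≡ (t ≐ t ⊃ ψ)
  eq = cong₂ _⊃_ (cong₂ _≐_ (subTm-var a t) (subTm-∉ t a∉t)) (subF-∉ ψ a∉ψ)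

-- Environments and combinatory polynomials

Env : List Ty → Set
Env = All Tm

NotIn : Ty → ℕ → Env Δ → Set
NotIn τ k [] = ⊤
NotIn τ k (t ∷ e) = occursTm τ k t ≡ false × NotIn τ k e

fresh* : Env Δ → ℕ
fresh* [] = 0
fresh* (t ∷ e) = fresh t ⊔ fresh* e

fresh*-∉ : (e : Env Δ) → ∀ {n} → fresh* e ≤ n → NotIn τ n e
fresh*-∉ [] le = tt
fresh*-∉ (t ∷ e) le = fresh-∉ t (m⊔n≤o⇒m≤o (fresh t) _ le) , fresh*-∉ e (m⊔n≤o⇒n≤o (fresh t) _ le)

NotIn-++ : ∀ {k} (e : Env Δ) {e′ : Env Θ} → NotIn τ k e → NotIn τ k e′ → NotIn τ k (++⁺ e e′)
NotIn-++ [] p q = q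
NotIn-++ (t ∷ e) (p , ps) q = p , NotIn-++ e ps q

infix 1 _⊩_≐*_
_⊩_≐*_ : Fm HAω → Env Δ → Env Δ → Set
Γ ⊩ [] ≐* [] = ⊤
Γ ⊩ s ∷ e ≐* t ∷ e′ = (Γ ⊩ s ≐ t) × (Γ ⊩ e ≐* e′)

≐*-refl : (e : Env Δ) → Γ ⊩ e ≐* e
≐*-refl [] = tt
≐*-refl (t ∷ e) = ≐r , ≐*-refl e

≐*-sym : (e e′ : Env Δ) → Γ ⊩ e ≐* e′ → Γ ⊩ e′ ≐* e
≐*-sym [] [] _ = tt
≐*-sym (t ∷ e) (t′ ∷ e′) (p , ps) = ≐s p , ≐*-sym e e′ ps

≐*-wk : Γ′ ⊩ Γ → (e e′ : Env Δ) → Γ ⊩ e ≐* e′ → Γ′ ⊩ e ≐* e′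
≐*-wk w [] [] _ = tt
≐*-wk w (t ∷ e) (t′ ∷ e′) (p , ps) = wk w p , ≐*-wk w e e′ ps

≐*-++ : (e e′ : Env Δ) (r : Env Θ) → Γ ⊩ e ≐* e′ → Γ ⊩ ++⁺ e r ≐* ++⁺ e′ r
≐*-++ [] [] r _ = ≐*-refl r
≐*-++ (t ∷ e) (t′ ∷ e′) r (p , ps) = p , ≐*-++ e e′ r ps

-- Nameless terms: evaluation at an environment of arbitrary terms plays the role of substitution,
-- so β-equations carry no capture conditions. A closed term enters as an atom through `cl`, and
-- abstraction does not look inside it.
data Poly (Δ : List Ty) : Ty → Set where
  pv  : σ ∈ Δ → Poly Δ σ
  cl  : (t : Tm σ) → Closed t → Poly Δ σ
  _∙_ : Poly Δ (σ ⇒ τ) → Poly Δ σ → Poly Δ τ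

infixl 9 _∙_

⟦_⟧ : Poly Δ σ → Env Δ → Tm σ
⟦ pv i ⟧ e = lookup e i
⟦ cl t _ ⟧ e = t
⟦ p ∙ q ⟧ e = ⟦ p ⟧ e · ⟦ q ⟧ e

⟦⟧-closed : (p : Poly [] σ) → Closed (⟦ p ⟧ [])
⟦⟧-closed (cl t c) = c
⟦⟧-closed (p ∙ q) = ∧-true (⟦⟧-closed p) (⟦⟧-closed q)

lookup-cong : (e e′ : Env Δ) → Γ ⊩ e ≐* e′ → (i : σ ∈ Δ) → Γ ⊩ lookup e i ≐ lookup e′ i
lookup-cong (t ∷ e) (t′ ∷ e′) (p , ps) (here refl) = p
lookup-cong (t ∷ e) (t′ ∷ e′) (p , ps) (there i) = lookup-cong e e′ ps i

lookup-∉ : ∀ {k} (e : Env Δ) → NotIn τ k e → (i : σ ∈ Δ) → occursTm τ k (lookup e i) ≡ false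
lookup-∉ (t ∷ e) (p , ps) (here refl) = p
lookup-∉ (t ∷ e) (p , ps) (there i) = lookup-∉ e ps i

⟦⟧-cong : (p : Poly Δ σ) (e e′ : Env Δ) → Γ ⊩ e ≐* e′ → Γ ⊩ ⟦ p ⟧ e ≐ ⟦ p ⟧ e′
⟦⟧-cong (pv i) e e′ q = lookup-cong e e′ q i
⟦⟧-cong (cl t _) e e′ q = ≐r
⟦⟧-cong (p ∙ r) e e′ q = ⟦⟧-cong p e e′ q ·≐ ⟦⟧-cong r e e′ q

⟦⟧-∉ : ∀ {k} (p : Poly Δ σ) (e : Env Δ) → NotIn τ k e → occursTm τ k (⟦ p ⟧ e) ≡ false
⟦⟧-∉ (pv i) e q = lookup-∉ e q i
⟦⟧-∉ (cl t c) e q = closed-∉ t c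
⟦⟧-∉ (p ∙ r) e q = ∨-false (⟦⟧-∉ p e q) (⟦⟧-∉ r e q)

pc : Const σ → Poly Δ σ
pc c = cl (con c) refl

lam : Poly (σ ∷ Δ) τ → Poly Δ (σ ⇒ τ)
lam {σ} (pv (here refl)) = pc (sc σ (σ ⇒ σ) σ) ∙ pc (kc σ (σ ⇒ σ)) ∙ pc (kc σ σ)
lam (pv (there i)) = pc (kc _ _) ∙ pv i
lam (cl t c) = pc (kc _ _) ∙ cl t c
lam (p ∙ q) = pc (sc _ _ _) ∙ lam p ∙ lam q

β : (p : Poly (σ ∷ Δ) τ) (e : Env Δ) {u : Tm σ} → Γ ⊩ ⟦ lam p ⟧ e · u ≐ ⟦ p ⟧ (u ∷ e)
β (pv (here refl)) e = thm (ax (s-ax _ _ _)) ◾ thm (ax (k-ax _ _))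
β (pv (there i)) e = thm (ax (k-ax _ _))
β (cl t _) e = thm (ax (k-ax _ _))
β (p ∙ q) e = thm (ax (s-ax _ _ _)) ◾ β p e ·≐ β q e

-- Formulas with parameters

-- A parametrised formula is a function of its parameters, since its bound names may change with
-- them. `resp` stands in for the substitution lemma, and `free` says that free variables come from
-- the parameters only.
record Fam (Δ : List Ty) : Set where
  field
    fm   : Env Δ → Fm HAω
    resp : ∀ {Γ} e e′ → Γ ⊩ e ≐* e′ → Γ ⊩ fm e → Γ ⊩ fm e′
    free : ∀ {τ k} e → NotIn τ k e → freeIn τ k (fm e) ≡ false
open Fam public

infixr 2 _⊃F_
_⊃F_ : Fam Δ → Fam Δ → Fam Δ
fm (P ⊃F Q) e = fm P e ⊃ fm Q e
resp (P ⊃F Q) e e′ q h = ⊃I′ λ w a →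
  resp Q e e′ (≐*-wk w e e′ q) (ap (wk w h) (resp P e′ e (≐*-sym e e′ (≐*-wk w e e′ q)) a))
free (P ⊃F Q) e q = ∨-false (free P e q) (free Q e q)

⊥F : Fam Δ
fm ⊥F e = ⊥ᶠ
resp ⊥F e e′ q h = h
free ⊥F e q = refl

infix 5 _≐F_
_≐F_ : Poly Δ σ → Poly Δ σ → Fam Δ
fm (p ≐F q) e = ⟦ p ⟧ e ≐ ⟦ q ⟧ e
resp (p ≐F q) e e′ w h = ≐s (⟦⟧-cong p e e′ w) ◾ h ◾ ⟦⟧-cong q e e′ w
free (p ≐F q) e w = ∨-false (⟦⟧-∉ p e w) (⟦⟧-∉ q e w)

-- Consecutive names, because `dom` at a function type binds `n`, `suc n`, `suc (suc n)`: both of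
-- its quantifier blocks are then literally instances.
∀* : (Δ : List Ty) → ℕ → (Env Δ → Fm HAω) → Fm HAω
∀* [] n Q = Q []
∀* (σ ∷ Δ) n Q = ∀ᶠ σ n (∀* Δ (suc n) λ e → Q (var n ∷ e))

vars : (Δ : List Ty) → ℕ → Env Δ
vars [] n = []
vars (σ ∷ Δ) n = var n ∷ vars Δ (suc n)

Names : (Ty → ℕ → Set) → List Ty → ℕ → Set
Names P [] n = ⊤
Names P (σ ∷ Δ) n = P σ n × Names P Δ (suc n)

Names-tab : {P : Ty → ℕ → Set} → ∀ Δ {n} → (∀ σ k → n ≤ k → k < n + length Δ → P σ k) → Names P Δ n
Names-tab [] h = tt
Names-tab (σ ∷ Δ) {n} h =
  h σ n ≤-refl (subst (n <_) (sym (+-suc n (length Δ))) (s≤s (m≤m+n n _))) ,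
  Names-tab Δ λ τ k le lt → h τ k (<⇒≤ le) (subst (k <_) (sym (+-suc n (length Δ))) lt)

Names-map : {P Q : Ty → ℕ → Set} → ∀ Δ {n} → (∀ σ k → n ≤ k → k < n + length Δ → P σ k → Q σ k) →
            Names P Δ n → Names Q Δ n
Names-map [] h _ = tt
Names-map (σ ∷ Δ) {n} h (p , ps) =
  h σ n ≤-refl (subst (n <_) (sym (+-suc n (length Δ))) (s≤s (m≤m+n n _))) p ,
  Names-map Δ (λ τ k le lt → h τ k (<⇒≤ le) (subst (k <_) (sym (+-suc n (length Δ))) lt)) ps

∉-var : ∀ {σ τ n k} → n ≢ k → occursTm τ k (var {σ} n) ≡ false
∉-var d = eqV-false λ _ → d

∉-vars : ∀ Δ {n k} → (∀ j → n ≤ j → j < n + length Δ → j ≢ k) → NotIn τ k (vars Δ n)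
∉-vars [] h = tt
∉-vars (σ ∷ Δ) {n} h =
  ∉-var (h n ≤-refl (subst (n <_) (sym (+-suc n (length Δ))) (s≤s (m≤m+n n _)))) ,
  ∉-vars Δ λ j le lt → h j (<⇒≤ le) (subst (j <_) (sym (+-suc n (length Δ))) lt)

∀*-free : ∀ Δ n {Q : Env Δ → Fm HAω} {k} → (∀ e → NotIn τ k e → freeIn τ k (Q e) ≡ false) →
          freeIn τ k (∀* Δ n Q) ≡ false
∀*-free [] n h = h [] tt
∀*-free {τ} (σ ∷ Δ) n {k = k} h = if-false (eqV σ n τ k) λ b → ∀*-free Δ (suc n) λ e q → h (var n ∷ e) (b , q)

∀*-own : ∀ Δ n {Q : Env Δ → Fm HAω} → Γ ⊩ ∀* Δ n Q → Γ ⊩ Q (vars Δ n)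
∀*-own [] n h = h
∀*-own (σ ∷ Δ) n h = ∀*-own Δ (suc n) (∀-own n h)

∀*-gen : ∀ Δ n {Q : Env Δ → Fm HAω} → Names (λ σ k → freeIn σ k Γ ≡ false) Δ n →
         Γ ⊩ Q (vars Δ n) → Γ ⊩ ∀* Δ n Q
∀*-gen [] n _ h = h
∀*-gen (σ ∷ Δ) n (p , ps) h = ∀I n p (∀*-gen Δ (suc n) ps h)

letEq* : ∀ Δ n (e : Env Δ) →
         Names (λ σ k → freeIn σ k Γ ≡ false × NotIn σ k e × freeIn σ k ψ ≡ false) Δ n →
         (∀ {Γ′} → Γ′ ⊩ Γ → Γ′ ⊩ vars Δ n ≐* e → Γ′ ⊩ ψ) → Γ ⊩ ψ
letEq* [] n [] _ h = h hyp tt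
letEq* (σ ∷ Δ) n (t ∷ e) ((a , (b , _) , c) , ps) h =
  letEq n t a b c (letEq* Δ (suc n) e
    -- The equation added to the hypothesis mentions `var n`; the remaining names have larger
    -- indices and so stay fresh.
    (Names-map Δ (λ { σ′ k le _ (a′ , (b′ , b″) , c′) →
       ∨-false a′ (∨-false (∉-var (<⇒≢ le)) b′) , b″ , c′ }) ps)
    λ w q → h (∧E₁′ w) (∧E₂′ w , q))

module _ (Q : Fam (Δ ++ Θ)) (r : Env Θ) where
  private
    Q′ : Env Δ → Fm HAω
    Q′ e = fm Q (++⁺ e r)

    free′ : ∀ {k} e → NotIn τ k r → NotIn τ k e → freeIn τ k (Q′ e) ≡ false
    free′ e q q′ = free Q (++⁺ e r) (NotIn-++ e q′ q)

    all-free : ∀ {k} n → NotIn τ k r → freeIn τ k (∀* Δ n Q′) ≡ false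
    all-free n q = ∀*-free Δ n λ e → free′ e q

    move : ∀ n e → Names (λ σ k → freeIn σ k Γ ≡ false × NotIn σ k e × NotIn σ k r) Δ n →
           Γ ⊩ Q′ (vars Δ n) → Γ ⊩ Q′ e
    move n e ns h = letEq* Δ n e
      (Names-map Δ (λ σ k _ _ → λ { (a , b , c) → a , b , free′ e c b }) ns)
      λ w q → resp Q _ _ (≐*-++ _ e r q) (wk w h)

  -- The bound names may occur in `e`, which `letEq` forbids, so the block is moved to names above
  -- everything in sight and from there to `e`. Taking the universal formula as sole hypothesis
  -- keeps the names independent of `Γ`.
  ∀*-elim : ∀ n → Names (λ σ k → NotIn σ k r) Δ n → Γ ⊩ ∀* Δ n Q′ → ∀ e → Γ ⊩ Q′ e
  ∀*-elim {Γ} n ns h e = wk h (move M e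
      (Names-tab Δ λ σ k le _ → all-free n (fresh*-∉ r (≤-trans r≤M le)) ,
                                fresh*-∉ e (≤-trans e≤M le) , fresh*-∉ r (≤-trans r≤M le))
      (move n (vars Δ M)
        (Names-map Δ (λ σ k le lt q → all-free n q ,
            ∉-vars Δ (λ { j M≤j _ refl → <-irrefl refl (<-≤-trans lt (≤-trans n≤M M≤j)) }) , q) ns)
        (∀*-own Δ n hyp)))
    where
    M : ℕ
    M = (n + length Δ) ⊔ (fresh* e ⊔ fresh* r)
    n≤M : n + length Δ ≤ M
    n≤M = m≤m⊔n _ _
    e≤M : fresh* e ≤ M
    e≤M = ≤-trans (m≤m⊔n _ _) (m≤n⊔m (n + length Δ) _)
    r≤M : fresh* r ≤ M
    r≤M = ≤-trans (m≤n⊔m (fresh* e) _) (m≤n⊔m (n + length Δ) _)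

  -- The names `n` onwards may be free in `Γ`. Generalisation is therefore done at fresh names, and
  -- the resulting formula, in which the wanted names are not free, is renamed on its own.
  ∀*-intro : ∀ n → Names (λ σ k → NotIn σ k r) Δ n → (∀ e → Γ ⊩ Q′ e) → Γ ⊩ ∀* Δ n Q′
  ∀*-intro {Γ} n ns h = wk gen (∀*-gen Δ n (Names-map Δ (λ σ k _ _ → all-free M) ns)
      (∀*-elim M (Names-tab Δ λ σ k le _ → fresh*-∉ r (≤-trans (m≤n⊔m (freshF Γ) _) le)) hyp (vars Δ n)))
    where
    M : ℕ
    M = freshF Γ ⊔ fresh* r
    gen : Γ ⊩ ∀* Δ M Q′
    gen = ∀*-gen Δ M (Names-tab Δ λ σ k le _ → freshF-∉ Γ (≤-trans (m≤m⊔n _ _) le)) (h (vars Δ M))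

∀F : Fam (σ ∷ Δ) → Fam Δ
fm (∀F {σ} Q) r = ∀ᶠ σ (fresh* r) (fm Q (var (fresh* r) ∷ r))
resp (∀F {σ} Q) r r′ q h =
  ∀*-intro {Δ = σ ∷ []} Q r′ (fresh* r′) (fresh*-∉ r′ ≤-refl , tt) λ { (t ∷ []) →
    resp Q (t ∷ r) (t ∷ r′) (≐r , q)
      (∀*-elim {Δ = σ ∷ []} Q r (fresh* r) (fresh*-∉ r ≤-refl , tt) h (t ∷ [])) }
free (∀F {σ} Q) r q = ∀*-free (σ ∷ []) (fresh* r) {λ e → fm Q (++⁺ e r)} λ { (t ∷ []) (p , _) → free Q (t ∷ r) (p , q) }

∀F-elim : (Q : Fam (σ ∷ Δ)) (r : Env Δ) → Γ ⊩ fm (∀F Q) r → ∀ t → Γ ⊩ fm Q (t ∷ r)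
∀F-elim {σ} Q r h t = ∀*-elim {Δ = σ ∷ []} Q r (fresh* r) (fresh*-∉ r ≤-refl , tt) h (t ∷ [])

∀F-intro : (Q : Fam (σ ∷ Δ)) (r : Env Δ) → (∀ t → Γ ⊩ fm Q (t ∷ r)) → Γ ⊩ fm (∀F Q) r
∀F-intro {σ} Q r h = ∀*-intro {Δ = σ ∷ []} Q r (fresh* r) (fresh*-∉ r ≤-refl , tt) λ { (t ∷ []) → h t }

-- The induction axiom is applied to ∀ m (m ≐ n ⊃ P m), in which n only occurs in an equation.
induction : (P : Fam (o ∷ Δ)) (r : Env Δ) →
            Γ ⊩ fm P (con zeroc ∷ r) →
            (∀ {Γ′} → Γ′ ⊩ Γ → ∀ u → Γ′ ⊩ fm P (u ∷ r) → Γ′ ⊩ fm P (con succ · u ∷ r)) →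
            ∀ t → Γ ⊩ fm P (t ∷ r)
induction {Δ} {Γ} P r z s t =
  -- The induction is carried out on the variable `var M`; identifying it with `t` covers all terms.
  letEq M t (freshF-∉ Γ Γ≤M) (fresh-∉ t t≤M) (free P (t ∷ r) (fresh-∉ t t≤M , fresh*-∉ r r≤M))
    (resp P _ _ (∧E₂ , ≐*-refl r) (Φ-elim (var M) ≤-refl (wk ∧E₁ (∀-own M ind′))))
  where
  M : ℕ
  M = freshF Γ ⊔ (fresh t ⊔ fresh* r)
  Γ≤M : freshF Γ ≤ M
  Γ≤M = m≤m⊔n _ _
  t≤M : fresh t ≤ M
  t≤M = ≤-trans (m≤m⊔n _ _) (m≤n⊔m (freshF Γ) _)
  r≤M : fresh* r ≤ M
  r≤M = ≤-trans (m≤n⊔m (fresh t) _) (m≤n⊔m (freshF Γ) _)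
  Ψ : Fam (o ∷ o ∷ Δ)
  fm Ψ (m ∷ n ∷ e) = m ≐ n ⊃ fm P (m ∷ e)
  resp Ψ (m ∷ n ∷ e) (m′ ∷ n′ ∷ e′) (p , q , ps) h = ⊃I′ λ w a →
    resp P _ _ (wk w p , ≐*-wk w e e′ ps) (ap (wk w h) (wk w p ◾ a ◾ ≐s (wk w q)))
  free Ψ (m ∷ n ∷ e) (p , q , ps) = ∨-false (∨-false p q) (free P _ (p , ps))
  Φ : Tm o → Fm HAω
  Φ u = ∀ᶠ o (suc M) (var (suc M) ≐ u ⊃ fm P (var (suc M) ∷ r))
  notin : ∀ u → fresh u ≤ suc M → Names (λ σ k → NotIn σ k (u ∷ r)) (o ∷ []) (suc M)
  notin u le = (fresh-∉ u le , fresh*-∉ r (≤-trans r≤M (n≤1+n M))) , tt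
  -- The bound `suc M` is just large enough for the three terms concerned: zero, `var M` and its
  -- successor.
  Φ-elim : ∀ {Γ′} u → fresh u ≤ suc M → Γ′ ⊩ Φ u → Γ′ ⊩ fm P (u ∷ r)
  Φ-elim u le h = ap (∀*-elim {Δ = o ∷ []} Ψ (u ∷ r) (suc M) (notin u le) h (u ∷ [])) ≐r
  Φ-intro : ∀ {Γ′} u → fresh u ≤ suc M → Γ′ ⊩ fm P (u ∷ r) → Γ′ ⊩ Φ u
  Φ-intro u le h = ∀*-intro {Δ = o ∷ []} Ψ (u ∷ r) (suc M) (notin u le) λ { (v ∷ []) →
    ⊃I′ λ w a → resp P _ _ (≐s a , ≐*-refl r) (wk w h) }
  Φ-sub : ∀ u → subF M u (Φ (var M)) ≡ Φ u
  Φ-sub u rewrite eqV-false {o} {suc M} {o} {M} (λ _ → 1+n≢n) =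
    cong (∀ᶠ o (suc M)) (cong₂ _⊃_
      (cong₂ _≐_ (subTm-∉ {τ = o} {M} {u} (var (suc M)) (∉-var {o} {o} 1+n≢n)) (subTm-var M u))
      (subF-∉ (fm P (var (suc M) ∷ r)) (free P _ (∉-var {o} {o} 1+n≢n , fresh*-∉ r r≤M))))
  ind′ : Γ ⊩ ∀ᶠ o M (Φ (var M))
  ind′ = ap (ap (thm (ax (ind M (Φ (var M)))))
    (subst (Γ ⊩_) (sym (Φ-sub (con zeroc))) (Φ-intro (con zeroc) z≤n z)))
    (∀I M (freshF-∉ Γ Γ≤M) (⊃I′ λ {Γ′} w h → subst (Γ′ ⊩_) (sym (Φ-sub (con succ · var M)))
      (Φ-intro (con succ · var M) ≤-refl (s w (var M) (Φ-elim (var M) ≤-refl h)))))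

-- The predicates dom and app

infixl 8 _⋆_ _⋆ₚ_
-- Agrees with _*_, but its types can be inferred (_⁺ is not a constructor).
_⋆_ : Tm ((σ ⇒ τ) ⊗ υ) → Tm σ → Tm τ
x ⋆ u = fstT x · u

fstP : Poly Δ (σ ⊗ τ) → Poly Δ σ
fstP p = pc (fstc _ _) ∙ p

sndP : Poly Δ (σ ⊗ τ) → Poly Δ τ
sndP p = pc (sndc _ _) ∙ p

pairP : Poly Δ σ → Poly Δ τ → Poly Δ (σ ⊗ τ)
pairP p q = pc (pairc _ _) ∙ p ∙ q

pairT : Tm σ → Tm τ → Tm (σ ⊗ τ)
pairT p q = con (pairc _ _) · p · q

_⋆ₚ_ : Poly Δ ((σ ⇒ τ) ⊗ υ) → Poly Δ σ → Poly Δ τ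
p ⋆ₚ q = fstP p ∙ q

pattern v0 = pv (here refl)
pattern v1 = pv (there (here refl))
pattern v2 = pv (there (there (here refl)))
pattern v3 = pv (there (there (there (here refl))))
pattern v4 = pv (there (there (there (there (here refl)))))
pattern v5 = pv (there (there (there (there (there (here refl))))))
pattern v6 = pv (there (there (there (there (there (there (here refl)))))))

fst≐ : {s t : Tm (σ ⊗ τ)} → Γ ⊩ s ≐ t → Γ ⊩ fstT s ≐ fstT t
fst≐ q = ≐r ·≐ q

snd≐ : {s t : Tm (σ ⊗ τ)} → Γ ⊩ s ≐ t → Γ ⊩ sndT s ≐ sndT t
snd≐ q = ≐r ·≐ q

infixl 8 _⋆≐_
_⋆≐_ : {s t : Tm ((σ ⇒ τ) ⊗ υ)} {u v : Tm σ} → Γ ⊩ s ≐ t → Γ ⊩ u ≐ v → Γ ⊩ s ⋆ u ≐ t ⋆ v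
p ⋆≐ q = fst≐ p ·≐ q

fst-pair : {s : Tm σ} {t : Tm τ} → Γ ⊩ fstT (pairT s t) ≐ s
fst-pair = thm (ax (fst-ax _ _))

snd-pair : {s : Tm σ} {t : Tm τ} → Γ ⊩ sndT (pairT s t) ≐ t
snd-pair = thm (ax (snd-ax _ _))

dom-free : ∀ σ {k} x → occursTm ρ k x ≡ false → freeIn ρ k (dom σ x) ≡ false
app-free : ∀ σ {k} x y z → occursTm ρ k x ≡ false → occursTm ρ k y ≡ false → occursTm ρ k z ≡ false →
           freeIn ρ k (app σ x y z) ≡ false
dom-free o x p = refl
dom-free (σ ⊗ τ) x p = ∨-false (dom-free σ (fstT x) p) (dom-free τ (sndT x) p)
dom-free {ρ} (σ ⇒ τ) {k} x p = ∨-false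
  (if-false (eqV (σ ⁺) n ρ k) λ a → ∨-false (dom-free σ (var n) a) (dom-free τ (fstT x · var n) (∨-false p a)))
  (if-false (eqV (σ ⁺) n ρ k) λ a → if-false (eqV (σ ⁺) (suc n) ρ k) λ b → if-false (eqV (τ ⁻) (suc (suc n)) ρ k) λ c →
    ∨-false (dom-free σ (var n) a) (∨-false (dom-free σ (var (suc n)) b) (∨-false
      (app-free τ (fstT x · var n) (fstT x · var (suc n)) (var (suc (suc n))) (∨-false p a) (∨-false p b) c)
      (app-free σ (var n) (var (suc n)) _ a b (∨-false (∨-false (∨-false p a) b) c)))))
  where n = fresh x
app-free o x y z p q r = ∨-false (∨-false p q) refl
app-free (σ ⊗ τ) x y z p q r = ∨-false
  (∨-false (∨-false r refl) (app-free σ (fstT x) (fstT y) _ p q r))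
  (∨-false (∨-false (∨-false r refl) refl) (app-free τ (sndT x) (sndT y) _ p q r))
app-free (σ ⇒ τ) x y z p q r = ∨-false (dom-free σ (fstT z) r)
  (app-free τ (fstT x · fstT z) (fstT y · fstT z) (sndT z) (∨-false p r) (∨-false q r) r)

-- Packaged by type so that families built from `dom` and `app` at `σ` and `τ` are available while
-- congruence at `σ ⇒ τ` is being proved.
record Congruent (σ : Ty) : Set where
  field
    dom-resp : ∀ {Γ x x′} → Γ ⊩ x ≐ x′ → Γ ⊩ dom σ x → Γ ⊩ dom σ x′
    app-resp : ∀ {Γ x x′ y y′ z z′} → Γ ⊩ x ≐ x′ → Γ ⊩ y ≐ y′ → Γ ⊩ z ≐ z′ →
               Γ ⊩ app σ x y z → Γ ⊩ app σ x′ y′ z′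
open Congruent

domF′ : Congruent σ → Poly Δ (σ ⁺) → Fam Δ
fm (domF′ {σ} C p) e = dom σ (⟦ p ⟧ e)
resp (domF′ C p) e e′ q = dom-resp C (⟦⟧-cong p e e′ q)
free (domF′ {σ} C p) e q = dom-free σ (⟦ p ⟧ e) (⟦⟧-∉ p e q)

appF′ : Congruent σ → Poly Δ (σ ⁺) → Poly Δ (σ ⁺) → Poly Δ (σ ⁻) → Fam Δ
fm (appF′ {σ} C p q r) e = app σ (⟦ p ⟧ e) (⟦ q ⟧ e) (⟦ r ⟧ e)
resp (appF′ C p q r) e e′ w = app-resp C (⟦⟧-cong p e e′ w) (⟦⟧-cong q e e′ w) (⟦⟧-cong r e e′ w)
free (appF′ {σ} C p q r) e w =
  app-free σ (⟦ p ⟧ e) (⟦ q ⟧ e) (⟦ r ⟧ e) (⟦⟧-∉ p e w) (⟦⟧-∉ q e w) (⟦⟧-∉ r e w)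

module Dom⇒ (σ τ : Ty) (Cσ : Congruent σ) (Cτ : Congruent τ) where
  Total : Fam (σ ⁺ ∷ (σ ⇒ τ) ⁺ ∷ [])
  Total = domF′ Cσ v0 ⊃F domF′ Cτ (v1 ⋆ₚ v0)

  Reflecting : Fam (σ ⁺ ∷ σ ⁺ ∷ τ ⁻ ∷ (σ ⇒ τ) ⁺ ∷ [])
  Reflecting = domF′ Cσ v0 ⊃F domF′ Cσ v1 ⊃F appF′ Cτ (v3 ⋆ₚ v0) (v3 ⋆ₚ v1) v2 ⊃F
               appF′ Cσ v0 v1 (sndP v3 ∙ v0 ∙ v1 ∙ v2)

  private
    names : (Δ : List Ty) (x : Tm ((σ ⇒ τ) ⁺)) → Names (λ ρ k → NotIn ρ k (x ∷ [])) Δ (fresh x)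
    names Δ x = Names-tab Δ λ ρ k le _ → fresh-∉ x le , tt

  elim₁ : ∀ {x} → Γ ⊩ dom (σ ⇒ τ) x → ∀ u → Γ ⊩ dom σ u ⊃ dom τ (x ⋆ u)
  elim₁ {x = x} h u = ∀*-elim {Δ = _ ∷ []} Total (x ∷ []) (fresh x) (names _ x) (∧E₁′ h) (u ∷ [])

  elim₂ : ∀ {x} → Γ ⊩ dom (σ ⇒ τ) x → ∀ u v w →
          Γ ⊩ dom σ u ⊃ dom σ v ⊃ app τ (x ⋆ u) (x ⋆ v) w ⊃ app σ u v (sndT x · u · v · w)
  elim₂ {x = x} h u v w =
    ∀*-elim {Δ = _ ∷ _ ∷ _ ∷ []} Reflecting (x ∷ []) (fresh x) (names _ x) (∧E₂′ h) (u ∷ v ∷ w ∷ [])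

  intro : ∀ {x} → (∀ u → Γ ⊩ dom σ u ⊃ dom τ (x ⋆ u)) →
          (∀ u v w → Γ ⊩ dom σ u ⊃ dom σ v ⊃ app τ (x ⋆ u) (x ⋆ v) w ⊃ app σ u v (sndT x · u · v · w)) →
          Γ ⊩ dom (σ ⇒ τ) x
  intro {x = x} f g = ∧I′
    (∀*-intro {Δ = _ ∷ []} Total (x ∷ []) (fresh x) (names _ x) λ { (u ∷ []) → f u })
    (∀*-intro {Δ = _ ∷ _ ∷ _ ∷ []} Reflecting (x ∷ []) (fresh x) (names _ x)
      λ { (u ∷ v ∷ w ∷ []) → g u v w })

-- At function types `x` and `x′` may give rise to different bound names, so the quantifiers are
-- eliminated and introduced again.
congruent : ∀ σ → Congruent σ
dom-resp (congruent o) q h = h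
dom-resp (congruent (σ ⊗ τ)) q h =
  ∧I′ (dom-resp (congruent σ) (fst≐ q) (∧E₁′ h)) (dom-resp (congruent τ) (snd≐ q) (∧E₂′ h))
dom-resp (congruent (σ ⇒ τ)) {x = x} {x′} q h = intro
    (λ u → resp Total (u ∷ x ∷ []) (u ∷ x′ ∷ []) (≐r , q , tt) (elim₁ h u))
    (λ u v w → resp Reflecting (u ∷ v ∷ w ∷ x ∷ []) (u ∷ v ∷ w ∷ x′ ∷ []) (≐r , ≐r , ≐r , q , tt) (elim₂ h u v w))
  where open Dom⇒ σ τ (congruent σ) (congruent τ)
app-resp (congruent o) p q r h = ⊃I′ λ w e → ap (wk w h) (wk w p ◾ e ◾ ≐s (wk w q))
app-resp (congruent (σ ⊗ τ)) p q r h = ∧I′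
  (⊃I′ λ w e → app-resp (congruent σ) (wk w (fst≐ p)) (wk w (fst≐ q)) (wk w (fst≐ (fst≐ r)))
    (ap (wk w (∧E₁′ h)) (wk w (snd≐ r) ◾ e)))
  (⊃I′ λ w e → app-resp (congruent τ) (wk w (snd≐ p)) (wk w (snd≐ q)) (wk w (snd≐ (fst≐ r)))
    (ap (wk w (∧E₂′ h)) (⊃I′ λ w′ e′ → ap (wk w′ e) (≐s (wk w′ (wk w (snd≐ r))) ◾ e′))))
app-resp (congruent (σ ⇒ τ)) p q r h = ∧I′
  (dom-resp (congruent σ) (fst≐ r) (∧E₁′ h))
  (app-resp (congruent τ) (p ⋆≐ fst≐ r) (q ⋆≐ fst≐ r) (snd≐ r) (∧E₂′ h))

domF : ∀ σ → Poly Δ (σ ⁺) → Fam Δ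
domF σ = domF′ (congruent σ)

appF : ∀ σ → Poly Δ (σ ⁺) → Poly Δ (σ ⁺) → Poly Δ (σ ⁻) → Fam Δ
appF σ = appF′ (congruent σ)

-- Wrapping the judgments makes σ, x, y, z inferable although dom and app are functions.
record Dom (Γ : Fm HAω) (σ : Ty) (x : Tm (σ ⁺)) : Set where
  constructor dom!
  field prf : Γ ⊩ dom σ x

record App (Γ : Fm HAω) (σ : Ty) (x y : Tm (σ ⁺)) (z : Tm (σ ⁻)) : Set where
  constructor app!
  field prf : Γ ⊩ app σ x y z

private variable
  x x′ y y′ : Tm σ
  z z′ : Tm τ

wkD : Γ′ ⊩ Γ → Dom Γ σ x → Dom Γ′ σ x
wkD w (dom! h) = dom! (wk w h)

wkA : Γ′ ⊩ Γ → App Γ σ x y z → App Γ′ σ x y z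
wkA w (app! h) = app! (wk w h)

respD : Γ ⊩ x ≐ x′ → Dom Γ σ x → Dom Γ σ x′
respD {σ = σ} q (dom! h) = dom! (dom-resp (congruent σ) q h)

respA : Γ ⊩ x ≐ x′ → Γ ⊩ y ≐ y′ → Γ ⊩ z ≐ z′ → App Γ σ x y z → App Γ σ x′ y′ z′
respA {σ = σ} p q r (app! h) = app! (app-resp (congruent σ) p q r h)

dom-· : ∀ {x u} → Dom Γ (σ ⇒ τ) x → Dom Γ σ u → Dom Γ τ (x ⋆ u)
dom-· {σ = σ} {τ} {u = u} (dom! h) (dom! k) =
  dom! (ap (Dom⇒.elim₁ σ τ (congruent σ) (congruent τ) h u) k)

dom-reflect : ∀ {x u v w} → Dom Γ (σ ⇒ τ) x → Dom Γ σ u → Dom Γ σ v →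
              App Γ τ (x ⋆ u) (x ⋆ v) w → App Γ σ u v (sndT x · u · v · w)
dom-reflect {σ = σ} {τ} (dom! h) (dom! k) (dom! l) (app! a) =
  app! (ap (ap (ap (Dom⇒.elim₂ σ τ (congruent σ) (congruent τ) h _ _ _) k) l) a)

dom-⇒I : ∀ {x} → (∀ {Γ′} → Γ′ ⊩ Γ → ∀ {u} → Dom Γ′ σ u → Dom Γ′ τ (x ⋆ u)) →
         (∀ {Γ′} → Γ′ ⊩ Γ → ∀ {u v w} → Dom Γ′ σ u → Dom Γ′ σ v → App Γ′ τ (x ⋆ u) (x ⋆ v) w →
           App Γ′ σ u v (sndT x · u · v · w)) →
         Dom Γ (σ ⇒ τ) x
dom-⇒I {σ = σ} {τ} f g = dom! (Dom⇒.intro σ τ (congruent σ) (congruent τ)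
  (λ u → ⊃I′ λ p h → Dom.prf (f p (dom! h)))
  (λ u v w → ⊃I′ λ p h → ⊃I′ λ q k → ⊃I′ λ r a →
    App.prf (g (wk r (wk q p)) (dom! (wk r (wk q h))) (dom! (wk r k)) (app! a))))

app-⇒I : ∀ {x y u w} → Dom Γ σ u → App Γ τ (x ⋆ u) (y ⋆ u) w → App Γ (σ ⇒ τ) x y (pairT u w)
app-⇒I d a with respD (≐s fst-pair) d | respA (≐r ⋆≐ ≐s fst-pair) (≐r ⋆≐ ≐s fst-pair) (≐s snd-pair) a
... | dom! d′ | app! a′ = app! (∧I′ d′ a′)

app-⇒E₁ : ∀ {x y z} → App Γ (σ ⇒ τ) x y z → Dom Γ σ (fstT z)
app-⇒E₁ (app! h) = dom! (∧E₁′ h)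

app-⇒E₂ : ∀ {x y z} → App Γ (σ ⇒ τ) x y z → App Γ τ (x ⋆ fstT z) (y ⋆ fstT z) (sndT z)
app-⇒E₂ (app! h) = app! (∧E₂′ h)

dom-⊗I : ∀ {x} → Dom Γ σ (fstT x) → Dom Γ τ (sndT x) → Dom Γ (σ ⊗ τ) x
dom-⊗I (dom! h) (dom! k) = dom! (∧I′ h k)

dom-⊗E₁ : ∀ {x} → Dom Γ (σ ⊗ τ) x → Dom Γ σ (fstT x)
dom-⊗E₁ (dom! h) = dom! (∧E₁′ h)

dom-⊗E₂ : ∀ {x} → Dom Γ (σ ⊗ τ) x → Dom Γ τ (sndT x)
dom-⊗E₂ (dom! h) = dom! (∧E₂′ h)

app-⊗I : ∀ {x y z} → (∀ {Γ′} → Γ′ ⊩ Γ → Γ′ ⊩ sndT z ≐ con zeroc → App Γ′ σ (fstT x) (fstT y) (fstT (fstT z))) →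
         (∀ {Γ′} → Γ′ ⊩ Γ → Γ′ ⊩ ¬ᶠ (sndT z ≐ con zeroc) → App Γ′ τ (sndT x) (sndT y) (sndT (fstT z))) →
         App Γ (σ ⊗ τ) x y z
app-⊗I f g = app! (∧I′ (⊃I′ λ p e → App.prf (f p e)) (⊃I′ λ p e → App.prf (g p e)))

app-⊗E₁ : ∀ {x y z} → App Γ (σ ⊗ τ) x y z → Γ ⊩ sndT z ≐ con zeroc → App Γ σ (fstT x) (fstT y) (fstT (fstT z))
app-⊗E₁ (app! h) e = app! (ap (∧E₁′ h) e)

app-⊗E₂ : ∀ {x y z} → App Γ (σ ⊗ τ) x y z → Γ ⊩ ¬ᶠ (sndT z ≐ con zeroc) → App Γ τ (sndT x) (sndT y) (sndT (fstT z))
app-⊗E₂ (app! h) e = app! (ap (∧E₂′ h) e)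

-- Numbers, decisions and functionals

zeroT : Tm o
zeroT = con zeroc

succT : Tm o → Tm o
succT n = con succ · n

zeroP : Poly Δ o
zeroP = pc zeroc

succP : Poly Δ o → Poly Δ o
succP p = pc succ ∙ p

recT : Tm σ → Tm (o ⇒ σ ⇒ σ) → Tm o → Tm σ
recT a f n = con (recc _) · a · f · n

recP : Poly Δ σ → Poly Δ (o ⇒ σ ⇒ σ) → Poly Δ o → Poly Δ σ
recP a f n = pc (recc _) ∙ a ∙ f ∙ n

rec-zero : ∀ {a f} → Γ ⊩ recT {σ} a f zeroT ≐ a
rec-zero = thm (ax (R0-ax _ _))

rec-succ : ∀ {a f n} → Γ ⊩ recT {σ} a f (succT n) ≐ f · n · recT a f n
rec-succ = thm (ax (RS-ax _ _ _))

β₂ : (p : Poly (σ ∷ τ ∷ Δ) υ) (e : Env Δ) {u : Tm τ} {v : Tm σ} →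
     Γ ⊩ ⟦ lam (lam p) ⟧ e · u · v ≐ ⟦ p ⟧ (v ∷ u ∷ e)
β₂ p e = (β (lam p) e ·≐ ≐r) ◾ β p _

β₃ : (p : Poly (ρ ∷ σ ∷ τ ∷ Δ) υ) (e : Env Δ) {u : Tm τ} {v : Tm σ} {w : Tm ρ} →
     Γ ⊩ ⟦ lam (lam (lam p)) ⟧ e · u · v · w ≐ ⟦ p ⟧ (w ∷ v ∷ u ∷ e)
β₃ p e = (β₂ (lam p) e ·≐ ≐r) ◾ β p _

condP : Poly Δ o → Poly Δ σ → Poly Δ σ → Poly Δ σ
condP n a b = recP a (pc (kc _ _) ∙ (pc (kc _ _) ∙ b)) n

condT : Tm o → Tm σ → Tm σ → Tm σ
condT n a b = recT a (con (kc _ _) · (con (kc _ _) · b)) n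

cond-resp : ∀ {n n′} {a b : Tm σ} → Γ ⊩ n ≐ n′ → Γ ⊩ condT n a b ≐ condT n′ a b
cond-resp q = ≐r ·≐ q

cond-zero : ∀ {n} {a b : Tm σ} → Γ ⊩ n ≐ zeroT → Γ ⊩ condT n a b ≐ a
cond-zero q = cond-resp q ◾ rec-zero

cond-succ : ∀ {n} {a b : Tm σ} → Γ ⊩ condT (succT n) a b ≐ b
cond-succ = rec-succ ◾ (thm (ax (k-ax _ _)) ·≐ ≐r) ◾ thm (ax (k-ax _ _))

absurd : Γ ⊩ ¬ᶠ φ → Γ ⊩ φ → Γ ⊩ ψ
absurd n h = exfalso (ap n h)

-- Induction serves as case analysis: it is what exhibits a nonzero number as a successor.
cond-nonzero : ∀ {n} {a b : Tm σ} → Γ ⊩ ¬ᶠ (n ≐ zeroT) → Γ ⊩ condT n a b ≐ b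
cond-nonzero {σ} {n = n} {a} {b} = ap (induction P (a ∷ b ∷ [])
    (⊃I′ λ _ h → absurd h ≐r)
    (λ _ u _ → ⊃I′ λ _ _ → cond-succ) n)
  where
  P : Fam (o ∷ σ ∷ σ ∷ [])
  P = (v0 ≐F zeroP ⊃F ⊥F) ⊃F condP v0 v1 v2 ≐F v2

cases : Γ ⊩ φ ∨ᶠ ψ → (∀ {Γ′} → Γ′ ⊩ Γ → Γ′ ⊩ φ → Γ′ ⊩ χ) → (∀ {Γ′} → Γ′ ⊩ Γ → Γ′ ⊩ ψ → Γ′ ⊩ χ) → Γ ⊩ χ
cases h f g = ap (ap (ap (thm ∨E) (⊃I′ f)) (⊃I′ g)) h

succ≢zero : ∀ {n} → Γ ⊩ ¬ᶠ (succT n ≐ zeroT)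
succ≢zero = thm (ax (S-ne0 _))

-- The source of every case distinction on numbers made inside the intuitionistic theory.
zero∨nonzero : ∀ n → Γ ⊩ (n ≐ zeroT) ∨ᶠ ¬ᶠ (n ≐ zeroT)
zero∨nonzero = induction P [] (ap (thm ∨I₁) ≐r) (λ _ u _ → ap (thm ∨I₂) succ≢zero)
  where
  P : Fam (o ∷ [])
  fm P (n ∷ []) = (n ≐ zeroT) ∨ᶠ ¬ᶠ (n ≐ zeroT)
  resp P (n ∷ []) (n′ ∷ []) (q , _) h = cases h
    (λ w e → ap (thm ∨I₁) (≐s (wk w q) ◾ e))
    (λ w e → ap (thm ∨I₂) (⊃I′ λ w′ e′ → ap (wk w′ e) (wk w′ (wk w q) ◾ e′)))
  free P (n ∷ []) (q , _) = ∨-false (∨-false q refl) (∨-false (∨-false q refl) refl)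

by-cases : ∀ n → (∀ {Γ′} → Γ′ ⊩ Γ → Γ′ ⊩ n ≐ zeroT → Γ′ ⊩ χ) →
           (∀ {Γ′} → Γ′ ⊩ Γ → Γ′ ⊩ ¬ᶠ (n ≐ zeroT) → Γ′ ⊩ χ) → Γ ⊩ χ
by-cases n = cases (zero∨nonzero n)

by-casesA : ∀ n → (∀ {Γ′} → Γ′ ⊩ Γ → Γ′ ⊩ n ≐ zeroT → App Γ′ σ x y z) →
            (∀ {Γ′} → Γ′ ⊩ Γ → Γ′ ⊩ ¬ᶠ (n ≐ zeroT) → App Γ′ σ x y z) → App Γ σ x y z
by-casesA n f g = app! (by-cases n (λ w e → App.prf (f w e)) (λ w e → App.prf (g w e)))

-- The equality test on numbers and the comparison terms

eqtBase : Poly [] (o ⇒ o)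
eqtBase = lam (condP v0 zeroP (succP zeroP))

eqtInner : Poly (o ∷ o ∷ o ∷ (o ⇒ o) ∷ o ∷ []) o
eqtInner = v3 ∙ v1

eqtStep : Poly (o ∷ (o ⇒ o) ∷ o ∷ []) o
eqtStep = recP (succP zeroP) (lam (lam eqtInner)) v0

-- Recursion on the first number produces functions, so the recursive call can take the predecessor
-- of the second number. Zero means equal.
eqtP : Poly [] (o ⇒ o ⇒ o)
eqtP = pc (recc (o ⇒ o)) ∙ eqtBase ∙ lam (lam (lam eqtStep))

eqt : Tm (o ⇒ o ⇒ o)
eqt = ⟦ eqtP ⟧ []

eqt-zero : ∀ {n} → Γ ⊩ eqt · zeroT · n ≐ condT n zeroT (succT zeroT)
eqt-zero = (rec-zero ·≐ ≐r) ◾ β (condP v0 zeroP (succP zeroP)) []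

eqt-succ : ∀ {m n} → Γ ⊩ eqt · succT m · n ≐ ⟦ eqtStep ⟧ (n ∷ eqt · m ∷ m ∷ [])
eqt-succ = (rec-succ ·≐ ≐r) ◾ β₃ eqtStep []

eqt-succ-zero : ∀ {m} → Γ ⊩ eqt · succT m · zeroT ≐ succT zeroT
eqt-succ-zero = eqt-succ ◾ rec-zero

eqt-succ-succ : ∀ {m n} → Γ ⊩ eqt · succT m · succT n ≐ eqt · m · n
eqt-succ-succ {m = m} {n} = eqt-succ ◾ rec-succ ◾ β₂ eqtInner (succT n ∷ eqt · m ∷ m ∷ [])

eqt-refl : ∀ n → Γ ⊩ eqt · n · n ≐ zeroT
eqt-refl = induction (cl eqt refl ∙ v0 ∙ v0 ≐F zeroP) [] (eqt-zero ◾ cond-zero ≐r) (λ _ u h → eqt-succ-succ ◾ h)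

-- The second number must be generalised before the induction on the first, since the successor case
-- refers to its predecessor.
eqt-sound : ∀ {m n} → Γ ⊩ eqt · m · n ≐ zeroT → Γ ⊩ m ≐ n
eqt-sound {m = m} {n} = ap (∀F-elim P (m ∷ []) (induction (∀F P) [] zeroCase succCase m) n)
  where
  P : Fam (o ∷ o ∷ [])
  P = cl eqt refl ∙ v1 ∙ v0 ≐F zeroP ⊃F v1 ≐F v0
  zeroCase : ∀ {Γ} → Γ ⊩ fm (∀F P) (zeroT ∷ [])
  zeroCase = ∀F-intro P (zeroT ∷ []) (induction P (zeroT ∷ [])
    (⊃I′ λ _ _ → ≐r)
    (λ _ u _ → ⊃I′ λ _ h → absurd succ≢zero (≐s (eqt-zero ◾ cond-succ) ◾ h)))
  succCase : ∀ {Γ Γ′} → Γ′ ⊩ Γ → ∀ u → Γ′ ⊩ fm (∀F P) (u ∷ []) → Γ′ ⊩ fm (∀F P) (succT u ∷ [])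
  succCase _ u h = ∀F-intro P (succT u ∷ []) (induction P (succT u ∷ [])
    (⊃I′ λ _ e → absurd succ≢zero (≐s eqt-succ-zero ◾ e))
    (λ w v _ → ⊃I′ λ w′ e → ≐r ·≐ ap (wk w′ (wk w (∀F-elim P (u ∷ []) h v))) (≐s eqt-succ-succ ◾ e)))

eqt-complete : ∀ {m n} → Γ ⊩ m ≐ n → Γ ⊩ eqt · m · n ≐ zeroT
eqt-complete q = (≐r ·≐ ≐s q) ◾ eqt-refl _

-- The evidence `v0` steers the comparison of `v2` with `v1` down to type 0: its flag picks a
-- component of a pair, its point is fed to a function.
difP : ∀ σ → Poly (σ ⁻ ∷ σ ⁺ ∷ σ ⁺ ∷ []) o
dif : ∀ σ → Tm (σ ⁺ ⇒ σ ⁺ ⇒ σ ⁻ ⇒ o)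
dif-closed : ∀ σ → Closed (dif σ)

difP o = cl eqt refl ∙ v2 ∙ v1
difP (σ ⊗ τ) = condP (sndP v0)
  (cl (dif σ) (dif-closed σ) ∙ fstP v2 ∙ fstP v1 ∙ fstP (fstP v0))
  (cl (dif τ) (dif-closed τ) ∙ sndP v2 ∙ sndP v1 ∙ sndP (fstP v0))
difP (σ ⇒ τ) = cl (dif τ) (dif-closed τ) ∙ (v2 ⋆ₚ fstP v0) ∙ (v1 ⋆ₚ fstP v0) ∙ sndP v0

dif σ = ⟦ lam (lam (lam (difP σ))) ⟧ []

dif-closed σ = ⟦⟧-closed (lam (lam (lam (difP σ))))

dif-β : ∀ σ {x y w} → Γ ⊩ dif σ · x · y · w ≐ ⟦ difP σ ⟧ (w ∷ y ∷ x ∷ [])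
dif-β σ = β₃ (difP σ) []

-- If w separates x from y, then dif · x · m · w decides whether w separates m from y
-- (value zero) or x from m.
dif-zero : ∀ σ {x m y w} → App Γ σ x y w → Γ ⊩ dif σ · x · m · w ≐ zeroT → App Γ σ m y w
dif-zero o (app! a) e = app! (⊃I′ λ w q → ap (wk w a) (wk w (eqt-sound (≐s (dif-β o) ◾ e)) ◾ q))
dif-zero (σ ⊗ τ) a e = app-⊗I
  (λ w q → dif-zero σ (app-⊗E₁ (wkA w a) q) (≐s (dif-β (σ ⊗ τ) ◾ cond-zero q) ◾ wk w e))
  (λ w q → dif-zero τ (app-⊗E₂ (wkA w a) q) (≐s (dif-β (σ ⊗ τ) ◾ cond-nonzero q) ◾ wk w e))
dif-zero (σ ⇒ τ) (app! a) e = app! (∧I′ (∧E₁′ a)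
  (App.prf (dif-zero τ (app! (∧E₂′ a)) (≐s (dif-β (σ ⇒ τ)) ◾ e))))

dif-nonzero : ∀ σ {x m y w} → App Γ σ x y w → Γ ⊩ ¬ᶠ (dif σ · x · m · w ≐ zeroT) → App Γ σ x m w
nonzero-resp : ∀ {m n} → Γ ⊩ m ≐ n → Γ ⊩ ¬ᶠ (m ≐ zeroT) → Γ ⊩ ¬ᶠ (n ≐ zeroT)
nonzero-resp q h = ⊃I′ λ w e → ap (wk w h) (wk w q ◾ e)
dif-nonzero o _ e = app! (⊃I′ λ w q → ap (wk w e) (dif-β o ◾ eqt-complete q))
dif-nonzero (σ ⊗ τ) a e = app-⊗I
  (λ w q → dif-nonzero σ (app-⊗E₁ (wkA w a) q) (nonzero-resp (dif-β (σ ⊗ τ) ◾ cond-zero q) (wk w e)))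
  (λ w q → dif-nonzero τ (app-⊗E₂ (wkA w a) q) (nonzero-resp (dif-β (σ ⊗ τ) ◾ cond-nonzero q) (wk w e)))
dif-nonzero (σ ⇒ τ) (app! a) e = app! (∧I′ (∧E₁′ a)
  (App.prf (dif-nonzero τ (app! (∧E₂′ a)) (nonzero-resp (dif-β (σ ⇒ τ)) e))))

-- Makes reflection vacuous wherever the compared values coincide; any default may then serve as
-- evidence.
app-irrefl : ∀ σ {x z} → App Γ σ x x z → Γ ⊩ φ
app-irrefl o (app! a) = absurd a ≐r
app-irrefl (σ ⊗ τ) {z = z} a = by-cases (sndT z)
  (λ w e → app-irrefl σ (app-⊗E₁ (wkA w a) e))
  (λ w e → app-irrefl τ (app-⊗E₂ (wkA w a) e))
app-irrefl (σ ⇒ τ) (app! a) = app-irrefl τ (app! (∧E₂′ a))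

-- Default terms and functionals with a reflecting part

dflt : ∀ σ → Tm σ
dflt o = zeroT
dflt (σ ⊗ τ) = con (pairc σ τ) · dflt σ · dflt τ
dflt (σ ⇒ τ) = con (kc τ σ) · dflt τ

dflt-closed : ∀ σ → Closed (dflt σ)
dflt-closed o = refl
dflt-closed (σ ⊗ τ) = ∧-true (dflt-closed σ) (dflt-closed τ)
dflt-closed (σ ⇒ τ) = dflt-closed τ

dfltP : Poly Δ σ
dfltP {σ = σ} = cl (dflt σ) (dflt-closed σ)

-- `A` is the value at the argument `v0`. In `B` the evidence against the two values is `v0`, and
-- the arguments compared are `v2` and `v1`, in this order.
Λ : ∀ σ τ → Poly (σ ⁺ ∷ Δ) (τ ⁺) → Poly (τ ⁻ ∷ σ ⁺ ∷ σ ⁺ ∷ Δ) (σ ⁻) → Poly Δ ((σ ⇒ τ) ⁺)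
Λ σ τ A B = pairP (lam A) (lam (lam (lam B)))

module _ (σ τ : Ty) (A : Poly (σ ⁺ ∷ Δ) (τ ⁺)) (B : Poly (τ ⁻ ∷ σ ⁺ ∷ σ ⁺ ∷ Δ) (σ ⁻)) where
  Λ-⋆ : (e : Env Δ) {u : Tm (σ ⁺)} → Γ ⊩ ⟦ Λ σ τ A B ⟧ e ⋆ u ≐ ⟦ A ⟧ (u ∷ e)
  Λ-⋆ e = (fst-pair ·≐ ≐r) ◾ β A e

  Λ-snd : (e : Env Δ) {u v : Tm (σ ⁺)} {w : Tm (τ ⁻)} →
          Γ ⊩ sndT (⟦ Λ σ τ A B ⟧ e) · u · v · w ≐ ⟦ B ⟧ (w ∷ v ∷ u ∷ e)
  Λ-snd e = (snd-pair ·≐ ≐r ·≐ ≐r ·≐ ≐r) ◾ β₃ B e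

  Λ-dom : (e : Env Δ) →
    (∀ {Γ′} → Γ′ ⊩ Γ → ∀ {u} → Dom Γ′ σ u → Dom Γ′ τ (⟦ A ⟧ (u ∷ e))) →
    (∀ {Γ′} → Γ′ ⊩ Γ → ∀ {u v w} → Dom Γ′ σ u → Dom Γ′ σ v →
      App Γ′ τ (⟦ A ⟧ (u ∷ e)) (⟦ A ⟧ (v ∷ e)) w → App Γ′ σ u v (⟦ B ⟧ (w ∷ v ∷ u ∷ e))) →
    Dom Γ (σ ⇒ τ) (⟦ Λ σ τ A B ⟧ e)
  Λ-dom e f g = dom-⇒I
    (λ p d → respD (≐s (Λ-⋆ e)) (f p d))
    (λ p d d′ a → respA ≐r ≐r (≐s (Λ-snd e)) (g p d d′ (respA (Λ-⋆ e) (Λ-⋆ e) ≐r a)))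

  Λ-app : (e e′ : Env Δ) → ∀ {w} → App Γ (σ ⇒ τ) (⟦ Λ σ τ A B ⟧ e) (⟦ Λ σ τ A B ⟧ e′) w →
          App Γ τ (⟦ A ⟧ (fstT w ∷ e)) (⟦ A ⟧ (fstT w ∷ e′)) (sndT w)
  Λ-app e e′ a = respA (Λ-⋆ e) (Λ-⋆ e′) ≐r (app-⇒E₂ a)

dom-o : ∀ {n} → Dom Γ o n
dom-o = dom! (thm (hyp {⊥ᶠ}))

-- The constants

module K⁺ (ρ σ : Ty) where
  P₂ : Poly (ρ ⁺ ∷ Δ) ((σ ⇒ ρ) ⁺)
  -- A constant function never has values apart.
  P₂ = Λ σ ρ v1 dfltP

  P₁ : Poly Δ ((ρ ⇒ σ ⇒ ρ) ⁺)
  P₁ = Λ ρ (σ ⇒ ρ) P₂ (sndP v0)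

  is-dom : Dom Γ (ρ ⇒ σ ⇒ ρ) (⟦ P₁ ⟧ [])
  is-dom = Λ-dom ρ (σ ⇒ ρ) P₂ (sndP v0) []
    (λ p {x} dx → Λ-dom σ ρ v1 dfltP (x ∷ [])
      (λ q dy → wkD q dx)
      (λ q dy dy′ a → app! (app-irrefl ρ a)))
    (λ p {x} {x′} dx dx′ a → Λ-app σ ρ v1 dfltP (x ∷ []) (x′ ∷ []) a)

  eqn : ∀ {x y} → Γ ⊩ ⟦ P₁ ⟧ [] ⋆ x ⋆ y ≐ x
  eqn {x = x} = (Λ-⋆ ρ (σ ⇒ ρ) P₂ (sndP v0) [] ⋆≐ ≐r) ◾ Λ-⋆ σ ρ v1 dfltP (x ∷ [])

module S⁺ (ρ σ τ : Ty) where
  A₃ : Poly (ρ ⁺ ∷ (ρ ⇒ σ) ⁺ ∷ (ρ ⇒ σ ⇒ τ) ⁺ ∷ Δ) (τ ⁺)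
  A₃ = v2 ⋆ₚ v0 ⋆ₚ (v1 ⋆ₚ v0)

  xz[yz] xz′[yz] : Poly (τ ⁻ ∷ ρ ⁺ ∷ ρ ⁺ ∷ (ρ ⇒ σ) ⁺ ∷ (ρ ⇒ σ ⇒ τ) ⁺ ∷ Δ) (τ ⁺)
  xz[yz] = v4 ⋆ₚ v2 ⋆ₚ (v3 ⋆ₚ v2)
  xz′[yz] = v4 ⋆ₚ v1 ⋆ₚ (v3 ⋆ₚ v2)

  -- The route from x z (y z) to x z' (y z') passes through x z' (y z).
  B₃ : Poly (τ ⁻ ∷ ρ ⁺ ∷ ρ ⁺ ∷ (ρ ⇒ σ) ⁺ ∷ (ρ ⇒ σ ⇒ τ) ⁺ ∷ Δ) (ρ ⁻)
  B₃ = condP (cl (dif τ) (dif-closed τ) ∙ xz[yz] ∙ xz′[yz] ∙ v0)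
    (sndP v3 ∙ v2 ∙ v1 ∙ (sndP (v4 ⋆ₚ v1) ∙ (v3 ⋆ₚ v2) ∙ (v3 ⋆ₚ v1) ∙ v0))
    (sndP v4 ∙ v2 ∙ v1 ∙ pairP (v3 ⋆ₚ v2) v0)

  P₃ : Poly ((ρ ⇒ σ) ⁺ ∷ (ρ ⇒ σ ⇒ τ) ⁺ ∷ Δ) ((ρ ⇒ τ) ⁺)
  P₃ = Λ ρ τ A₃ B₃

  -- The point z in the evidence is kept, and x z reflects the rest to evidence against y z and y'
  -- z.
  B₂ : Poly ((ρ ⇒ τ) ⁻ ∷ (ρ ⇒ σ) ⁺ ∷ (ρ ⇒ σ) ⁺ ∷ (ρ ⇒ σ ⇒ τ) ⁺ ∷ Δ) ((ρ ⇒ σ) ⁻)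
  B₂ = pairP (fstP v0) (sndP (v3 ⋆ₚ fstP v0) ∙ (v2 ⋆ₚ fstP v0) ∙ (v1 ⋆ₚ fstP v0) ∙ sndP v0)

  P₂ : Poly ((ρ ⇒ σ ⇒ τ) ⁺ ∷ Δ) (((ρ ⇒ σ) ⇒ ρ ⇒ τ) ⁺)
  P₂ = Λ (ρ ⇒ σ) (ρ ⇒ τ) P₃ B₂

  -- Evidence (y, (z, w)) against the two results becomes (z, (y z, w)), the same observation made
  -- directly on x and x'.
  B₁ : Poly (((ρ ⇒ σ) ⇒ ρ ⇒ τ) ⁻ ∷ (ρ ⇒ σ ⇒ τ) ⁺ ∷ (ρ ⇒ σ ⇒ τ) ⁺ ∷ Δ) ((ρ ⇒ σ ⇒ τ) ⁻)
  B₁ = pairP (fstP (sndP v0)) (pairP (fstP v0 ⋆ₚ fstP (sndP v0)) (sndP (sndP v0)))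

  P₁ : Poly Δ (((ρ ⇒ σ ⇒ τ) ⇒ (ρ ⇒ σ) ⇒ ρ ⇒ τ) ⁺)
  P₁ = Λ (ρ ⇒ σ ⇒ τ) ((ρ ⇒ σ) ⇒ ρ ⇒ τ) P₂ B₁

  reflect₃ : ∀ {x y z z′ w} → Dom Γ (ρ ⇒ σ ⇒ τ) x → Dom Γ (ρ ⇒ σ) y → Dom Γ ρ z → Dom Γ ρ z′ →
    App Γ τ (x ⋆ z ⋆ (y ⋆ z)) (x ⋆ z′ ⋆ (y ⋆ z′)) w →
    App Γ ρ z z′ (⟦ B₃ ⟧ (w ∷ z′ ∷ z ∷ y ∷ x ∷ []))
  reflect₃ dx dy dz dz′ a = by-casesA _
    -- The broken link lies between x z' (y z) and x z' (y z'), so evidence is pulled back through x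
    -- z' and then through y.
    (λ p e → respA ≐r ≐r (≐s (cond-zero e))
      (dom-reflect (wkD p dy) (wkD p dz) (wkD p dz′)
        (dom-reflect (dom-· (wkD p dx) (wkD p dz′)) (dom-· (wkD p dy) (wkD p dz)) (dom-· (wkD p dy) (wkD p dz′))
          (dif-zero τ (wkA p a) e))))
    -- Here x z and x z' differ at the point y z, which is evidence at type `σ ⇒ τ` that x reflects.
    (λ p e → respA ≐r ≐r (≐s (cond-nonzero e))
      (dom-reflect (wkD p dx) (wkD p dz) (wkD p dz′)
        (app-⇒I (dom-· (wkD p dy) (wkD p dz)) (dif-nonzero τ (wkA p a) e))))

  is-dom : Dom Γ ((ρ ⇒ σ ⇒ τ) ⇒ (ρ ⇒ σ) ⇒ ρ ⇒ τ) (⟦ P₁ ⟧ [])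
  is-dom = Λ-dom (ρ ⇒ σ ⇒ τ) ((ρ ⇒ σ) ⇒ ρ ⇒ τ) P₂ B₁ []
    (λ p {x} dx → Λ-dom (ρ ⇒ σ) (ρ ⇒ τ) P₃ B₂ (x ∷ [])
      (λ q {y} dy → Λ-dom ρ τ A₃ B₃ (y ∷ x ∷ [])
        (λ r dz → dom-· (dom-· (wkD r (wkD q dx)) dz) (dom-· (wkD r dy) dz))
        (λ r dz dz′ a → reflect₃ (wkD r (wkD q dx)) (wkD r dy) dz dz′ a))
      (λ q {y} {y′} dy dy′ a →
        let dz = app-⇒E₁ a in
        app-⇒I dz (dom-reflect (dom-· (wkD q dx) dz) (dom-· dy dz) (dom-· dy′ dz)
          (Λ-app ρ τ A₃ B₃ (y ∷ x ∷ []) (y′ ∷ x ∷ []) a))))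
    (λ p {x} {x′} {w} dx dx′ a →
      let dy = app-⇒E₁ a
          b  = Λ-app (ρ ⇒ σ) (ρ ⇒ τ) P₃ B₂ (x ∷ []) (x′ ∷ []) a
          dz = app-⇒E₁ b in
      app-⇒I dz (app-⇒I (dom-· dy dz)
        (Λ-app ρ τ A₃ B₃ (fstT w ∷ x ∷ []) (fstT w ∷ x′ ∷ []) b)))

  eqn : ∀ {x y z} → Γ ⊩ ⟦ P₁ ⟧ [] ⋆ x ⋆ y ⋆ z ≐ x ⋆ z ⋆ (y ⋆ z)
  eqn {x = x} {y} =
    ((Λ-⋆ (ρ ⇒ σ ⇒ τ) ((ρ ⇒ σ) ⇒ ρ ⇒ τ) P₂ B₁ [] ⋆≐ ≐r) ⋆≐ ≐r) ◾
    (Λ-⋆ (ρ ⇒ σ) (ρ ⇒ τ) P₃ B₂ (x ∷ []) ⋆≐ ≐r) ◾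
    Λ-⋆ ρ τ A₃ B₃ (y ∷ x ∷ [])

module Pair⁺ (σ τ : Ty) where
  A₂ : Poly (τ ⁺ ∷ σ ⁺ ∷ Δ) ((σ ⊗ τ) ⁺)
  A₂ = pairP v1 v0

  B₂ : Poly ((σ ⊗ τ) ⁻ ∷ τ ⁺ ∷ τ ⁺ ∷ σ ⁺ ∷ Δ) (τ ⁻)
  B₂ = sndP (fstP v0)

  P₂ : Poly (σ ⁺ ∷ Δ) ((τ ⇒ σ ⊗ τ) ⁺)
  P₂ = Λ τ (σ ⊗ τ) A₂ B₂

  B₁ : Poly ((τ ⇒ σ ⊗ τ) ⁻ ∷ σ ⁺ ∷ σ ⁺ ∷ Δ) (σ ⁻)
  B₁ = fstP (fstP (sndP v0))

  P₁ : Poly Δ ((σ ⇒ τ ⇒ σ ⊗ τ) ⁺)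
  P₁ = Λ σ (τ ⇒ σ ⊗ τ) P₂ B₁

  is-dom : Dom Γ (σ ⇒ τ ⇒ σ ⊗ τ) (⟦ P₁ ⟧ [])
  is-dom = Λ-dom σ (τ ⇒ σ ⊗ τ) P₂ B₁ []
    (λ p {x} dx → Λ-dom τ (σ ⊗ τ) A₂ B₂ (x ∷ [])
      (λ q dy → dom-⊗I (respD (≐s fst-pair) (wkD q dx)) (respD (≐s snd-pair) dy))
      -- Only the second component varies; a zero flag would set the fixed first component apart
      -- from itself.
      (λ q {w = w} dy dy′ a → by-casesA (sndT w)
        (λ r e → app! (app-irrefl σ (respA fst-pair fst-pair ≐r (app-⊗E₁ (wkA r a) e))))
        (λ r e → respA snd-pair snd-pair ≐r (app-⊗E₂ (wkA r a) e))))
    (λ p {x} {x′} {w} dx dx′ a →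
      let b = Λ-app τ (σ ⊗ τ) A₂ B₂ (x ∷ []) (x′ ∷ []) a in
      by-casesA (sndT (sndT w))
        (λ r e → respA fst-pair fst-pair ≐r (app-⊗E₁ (wkA r b) e))
        (λ r e → app! (app-irrefl τ (respA snd-pair snd-pair ≐r (app-⊗E₂ (wkA r b) e)))))

  eqn : ∀ {x y} → Γ ⊩ ⟦ P₁ ⟧ [] ⋆ x ⋆ y ≐ pairT x y
  eqn {x = x} = (Λ-⋆ σ (τ ⇒ σ ⊗ τ) P₂ B₁ [] ⋆≐ ≐r) ◾ Λ-⋆ τ (σ ⊗ τ) A₂ B₂ (x ∷ [])

module Fst⁺ (σ τ : Ty) where
  B₁ : Poly (σ ⁻ ∷ (σ ⊗ τ) ⁺ ∷ (σ ⊗ τ) ⁺ ∷ Δ) ((σ ⊗ τ) ⁻)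
  B₁ = pairP (pairP v0 dfltP) zeroP

  P₁ : Poly Δ ((σ ⊗ τ ⇒ σ) ⁺)
  P₁ = Λ (σ ⊗ τ) σ (fstP v0) B₁

  -- Flag zero directs evidence to the first component. Separate from `is-dom`, as the axiom for
  -- equality at product types needs the same evidence.
  reflect : ∀ {x y z} → App Γ σ (fstT x) (fstT y) z → App Γ (σ ⊗ τ) x y (pairT (pairT z (dflt (τ ⁻))) zeroT)
  reflect a = app-⊗I
    (λ q e → respA ≐r ≐r (≐s (fst≐ fst-pair ◾ fst-pair)) (wkA q a))
    (λ q e → app! (absurd e snd-pair))

  is-dom : Dom Γ (σ ⊗ τ ⇒ σ) (⟦ P₁ ⟧ [])
  is-dom = Λ-dom (σ ⊗ τ) σ (fstP v0) B₁ []
    (λ p d → dom-⊗E₁ d)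
    (λ p d d′ a → reflect a)

  eqn : ∀ {x} → Γ ⊩ ⟦ P₁ ⟧ [] ⋆ x ≐ fstT x
  eqn = Λ-⋆ (σ ⊗ τ) σ (fstP v0) B₁ []

module Snd⁺ (σ τ : Ty) where
  B₁ : Poly (τ ⁻ ∷ (σ ⊗ τ) ⁺ ∷ (σ ⊗ τ) ⁺ ∷ Δ) ((σ ⊗ τ) ⁻)
  B₁ = pairP (pairP dfltP v0) (succP zeroP)

  P₁ : Poly Δ ((σ ⊗ τ ⇒ τ) ⁺)
  P₁ = Λ (σ ⊗ τ) τ (sndP v0) B₁

  reflect : ∀ {x y z} → App Γ τ (sndT x) (sndT y) z → App Γ (σ ⊗ τ) x y (pairT (pairT (dflt (σ ⁻)) z) (succT zeroT))
  reflect a = app-⊗I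
    (λ q e → app! (absurd succ≢zero (≐s snd-pair ◾ e)))
    (λ q e → respA ≐r ≐r (≐s (snd≐ fst-pair ◾ snd-pair)) (wkA q a))

  is-dom : Dom Γ (σ ⊗ τ ⇒ τ) (⟦ P₁ ⟧ [])
  is-dom = Λ-dom (σ ⊗ τ) τ (sndP v0) B₁ []
    (λ p d → dom-⊗E₂ d)
    (λ p d d′ a → reflect a)

  eqn : ∀ {x} → Γ ⊩ ⟦ P₁ ⟧ [] ⋆ x ≐ sndT x
  eqn = Λ-⋆ (σ ⊗ τ) τ (sndP v0) B₁ []

module Succ⁺ where
  P₁ : Poly Δ ((o ⇒ o) ⁺)
  P₁ = Λ o o (succP v0) zeroP

  is-dom : Dom Γ (o ⇒ o) (⟦ P₁ ⟧ [])
  is-dom = Λ-dom o o (succP v0) zeroP []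
    (λ _ _ → dom-o)
    -- Apartness at type 0 is inequality, so reflection is the contrapositive of the congruence of
    -- the successor.
    (λ { p d d′ (app! a) → app! (⊃I′ λ w e → ap (wk w a) (≐r ·≐ e)) })

  eqn : ∀ {n} → Γ ⊩ ⟦ P₁ ⟧ [] ⋆ n ≐ succT n
  eqn = Λ-⋆ o o (succP v0) zeroP []

module Rec⁺ (σ : Ty) where
  Step : Ty
  Step = o ⇒ σ ⇒ σ

  itStep : Poly (σ ⁺ ∷ o ∷ Step ⁺ ∷ σ ⁺ ∷ []) (σ ⁺)
  itStep = v2 ⋆ₚ v1 ⋆ₚ v0

  itBody : Poly (Step ⁺ ∷ σ ⁺ ∷ []) (o ⇒ σ ⁺)
  itBody = pc (recc (σ ⁺)) ∙ v1 ∙ lam (lam itStep)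

  opaque
    it : Tm (σ ⁺ ⇒ Step ⁺ ⇒ o ⇒ σ ⁺)
    it = ⟦ lam (lam itBody) ⟧ []

    it-closed : Closed it
    it-closed = ⟦⟧-closed (lam (lam itBody))

    it-β : ∀ {x y} → Γ ⊩ it · x · y ≐ ⟦ itBody ⟧ (y ∷ x ∷ [])
    it-β = β₂ itBody []

  itP : Poly Δ (σ ⁺) → Poly Δ (Step ⁺) → Poly Δ o → Poly Δ (σ ⁺)
  itP x y m = cl it it-closed ∙ x ∙ y ∙ m

  it-zero : ∀ {x y} → Γ ⊩ it · x · y · zeroT ≐ x
  it-zero = (it-β ·≐ ≐r) ◾ rec-zero

  it-succ : ∀ {x y m} → Γ ⊩ it · x · y · succT m ≐ y ⋆ m ⋆ (it · x · y · m)
  it-succ {x = x} {y} = (it-β ·≐ ≐r) ◾ rec-succ ◾ β₂ itStep (y ∷ x ∷ []) ◾ (≐r ·≐ (≐s it-β ·≐ ≐r))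

  it-dom : ∀ {x y} → Dom Γ σ x → Dom Γ Step y → ∀ m → Dom Γ σ (it · x · y · m)
  it-dom {x = x} {y} dx dy m = dom! (induction (domF σ (itP v2 v1 v0)) (y ∷ x ∷ [])
    (Dom.prf (respD (≐s it-zero) dx))
    (λ p u h → Dom.prf (respD (≐s it-succ) (dom-· (dom-· (wkD p dy) dom-o) (dom! h)))) m)

  -- Varying the initial value: an observation at stage m is pulled back through m steps.
  pull₁Step : Poly (σ ⁻ ∷ (σ ⁻ ⇒ σ ⁻) ∷ o ∷ Step ⁺ ∷ σ ⁺ ∷ σ ⁺ ∷ []) (σ ⁻)
  pull₁Step = v1 ∙ (sndP (v3 ⋆ₚ v2) ∙ itP v5 v3 v2 ∙ itP v4 v3 v2 ∙ v0)

  -- Recursion at type `σ ⁻ ⇒ σ ⁻`, since the evidence changes at each stage. At stage 0 it already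
  -- concerns the initial values, whence the identity.
  pull₁Body : Poly (Step ⁺ ∷ σ ⁺ ∷ σ ⁺ ∷ []) (o ⇒ σ ⁻ ⇒ σ ⁻)
  pull₁Body = pc (recc _) ∙ lam v0 ∙ lam (lam (lam pull₁Step))

  opaque
    pull₁ : Tm (σ ⁺ ⇒ σ ⁺ ⇒ Step ⁺ ⇒ o ⇒ σ ⁻ ⇒ σ ⁻)
    pull₁ = ⟦ lam (lam (lam pull₁Body)) ⟧ []

    pull₁-closed : Closed pull₁
    pull₁-closed = ⟦⟧-closed (lam (lam (lam pull₁Body)))

    pull₁-β : ∀ {x x′ y} → Γ ⊩ pull₁ · x · x′ · y ≐ ⟦ pull₁Body ⟧ (y ∷ x′ ∷ x ∷ [])
    pull₁-β = β₃ pull₁Body []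

  pull₁-zero : ∀ {x x′ y w} → Γ ⊩ pull₁ · x · x′ · y · zeroT · w ≐ w
  pull₁-zero {x = x} {x′} {y} = (((pull₁-β ·≐ ≐r) ◾ rec-zero) ·≐ ≐r) ◾ β v0 (y ∷ x′ ∷ x ∷ [])

  pull₁-succ : ∀ {x x′ y m w} → Γ ⊩ pull₁ · x · x′ · y · succT m · w ≐
    pull₁ · x · x′ · y · m · (sndT (y ⋆ m) · (it · x · y · m) · (it · x′ · y · m) · w)
  pull₁-succ {x = x} {x′} {y} = (((pull₁-β ·≐ ≐r) ◾ rec-succ) ·≐ ≐r) ◾
    β₃ pull₁Step (y ∷ x′ ∷ x ∷ []) ◾ (≐s pull₁-β ·≐ ≐r ·≐ ≐r)

  reflect₁ : ∀ {x x′ y} → Dom Γ σ x → Dom Γ σ x′ → Dom Γ Step y → ∀ {m w} →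
    App Γ σ (it · x · y · m) (it · x′ · y · m) w → App Γ σ x x′ (pull₁ · x · x′ · y · m · w)
  -- The induction on the stage generalises over the evidence, which the step replaces by its
  -- pull-back.
  reflect₁ {Γ} {x} {x′} {y} dx dx′ dy {m} {w} (app! a) = app! (ap (∀F-elim P (m ∷ e)
      (induction (∀F P) e
        (∀F-intro P (zeroT ∷ e) λ w → ⊃I′ λ _ h →
          App.prf (respA it-zero it-zero (≐s pull₁-zero) (app! h)))
        (λ p u ih → ∀F-intro P (succT u ∷ e) λ w → ⊃I′ λ q h →
          App.prf (respA ≐r ≐r (≐s pull₁-succ)
            (app! (ap (wk q (∀F-elim P (u ∷ e) ih _))
              (App.prf (dom-reflect (dom-· (wkD q (wkD p dy)) dom-o)
                (it-dom (wkD q (wkD p dx)) (wkD q (wkD p dy)) u)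
                (it-dom (wkD q (wkD p dx′)) (wkD q (wkD p dy)) u)
                (respA it-succ it-succ ≐r (app! h))))))))
        m) w) a)
    where
    e : Env (Step ⁺ ∷ σ ⁺ ∷ σ ⁺ ∷ [])
    e = y ∷ x′ ∷ x ∷ []
    P : Fam (σ ⁻ ∷ o ∷ Step ⁺ ∷ σ ⁺ ∷ σ ⁺ ∷ [])
    P = appF σ (itP v4 v2 v1) (itP v3 v2 v1) v0 ⊃F appF σ v4 v3 (cl pull₁ pull₁-closed ∙ v4 ∙ v3 ∙ v2 ∙ v1 ∙ v0)

  -- Varying the step function: with r and r' the values at stage k, the route from y k r
  -- to y' k r' passes through y' k r.
  pull₂Step : Poly (σ ⁻ ∷ (σ ⁻ ⇒ Step ⁻) ∷ o ∷ Step ⁺ ∷ Step ⁺ ∷ σ ⁺ ∷ []) (Step ⁻)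
  pull₂Step = condP (cl (dif σ) (dif-closed σ) ∙ (v4 ⋆ₚ v2 ⋆ₚ itP v5 v4 v2) ∙ (v3 ⋆ₚ v2 ⋆ₚ itP v5 v4 v2) ∙ v0)
    (v1 ∙ (sndP (v3 ⋆ₚ v2) ∙ itP v5 v4 v2 ∙ itP v5 v3 v2 ∙ v0))
    (pairP v2 (pairP (itP v5 v4 v2) v0))

  -- Both sequences start from the same value, so stage 0 admits no evidence and a default is
  -- returned there.
  pull₂Body : Poly (Step ⁺ ∷ Step ⁺ ∷ σ ⁺ ∷ []) (o ⇒ σ ⁻ ⇒ Step ⁻)
  pull₂Body = pc (recc _) ∙ lam dfltP ∙ lam (lam (lam pull₂Step))

  opaque
    pull₂ : Tm (σ ⁺ ⇒ Step ⁺ ⇒ Step ⁺ ⇒ o ⇒ σ ⁻ ⇒ Step ⁻)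
    pull₂ = ⟦ lam (lam (lam pull₂Body)) ⟧ []

    pull₂-closed : Closed pull₂
    pull₂-closed = ⟦⟧-closed (lam (lam (lam pull₂Body)))

    pull₂-β : ∀ {x y y′} → Γ ⊩ pull₂ · x · y · y′ ≐ ⟦ pull₂Body ⟧ (y′ ∷ y ∷ x ∷ [])
    pull₂-β = β₃ pull₂Body []

  pull₂-succ : ∀ {x y y′ m w} → Γ ⊩ pull₂ · x · y · y′ · succT m · w ≐
    condT (dif σ · (y ⋆ m ⋆ (it · x · y · m)) · (y′ ⋆ m ⋆ (it · x · y · m)) · w)
      (pull₂ · x · y · y′ · m · (sndT (y′ ⋆ m) · (it · x · y · m) · (it · x · y′ · m) · w))
      (pairT m (pairT (it · x · y · m) w))
  pull₂-succ {x = x} {y} {y′} = (((pull₂-β ·≐ ≐r) ◾ rec-succ) ·≐ ≐r) ◾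
    β₃ pull₂Step (y′ ∷ y ∷ x ∷ []) ◾
    (≐r ·≐ (≐s pull₂-β ·≐ ≐r ·≐ ≐r) ·≐ ≐r ·≐ ≐r)

  reflect₂ : ∀ {x y y′} → Dom Γ σ x → Dom Γ Step y → Dom Γ Step y′ → ∀ {m w} →
    App Γ σ (it · x · y · m) (it · x · y′ · m) w → App Γ Step y y′ (pull₂ · x · y · y′ · m · w)
  reflect₂ {Γ} {x} {y} {y′} dx dy dy′ {m} {w} (app! a) = app! (ap (∀F-elim P (m ∷ e)
      (induction (∀F P) e
        (∀F-intro P (zeroT ∷ e) λ w → ⊃I′ λ _ h → app-irrefl σ (respA it-zero it-zero ≐r (app! h)))
        (λ p u ih → ∀F-intro P (succT u ∷ e) λ w → ⊃I′ λ q h →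
          let dy₁ = wkD q (wkD p dy)
              dy₂ = wkD q (wkD p dy′)
              d₁  = it-dom (wkD q (wkD p dx)) dy₁ u
              d₂  = it-dom (wkD q (wkD p dx)) dy₂ u
              a₁  = respA it-succ it-succ ≐r (app! h) in
          App.prf (respA ≐r ≐r (≐s pull₂-succ) (by-casesA _
            -- The second step function sends r and r' to values apart, so r and r' are apart
            -- already and the previous stage takes over.
            (λ r z → respA ≐r ≐r (≐s (cond-zero z))
              (app! (ap (wk r (wk q (∀F-elim P (u ∷ e) ih _)))
                (App.prf (dom-reflect (wkD r (dom-· dy₂ dom-o)) (wkD r d₁) (wkD r d₂) (dif-zero σ (wkA r a₁) z))))))
            -- The step functions themselves disagree at stage `u` and value r; these two points
            -- with the given evidence form evidence at type `Step`.
            (λ r z → respA ≐r ≐r (≐s (cond-nonzero z))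
              (app-⇒I dom-o (app-⇒I (wkD r d₁) (dif-nonzero σ (wkA r a₁) z)))))))
        m) w) a)
    where
    e : Env (Step ⁺ ∷ Step ⁺ ∷ σ ⁺ ∷ [])
    e = y′ ∷ y ∷ x ∷ []
    P : Fam (σ ⁻ ∷ o ∷ Step ⁺ ∷ Step ⁺ ∷ σ ⁺ ∷ [])
    P = appF σ (itP v4 v3 v1) (itP v4 v2 v1) v0 ⊃F
        appF Step v3 v2 (cl pull₂ pull₂-closed ∙ v4 ∙ v3 ∙ v2 ∙ v1 ∙ v0)

  A₃ : Poly (o ∷ Step ⁺ ∷ σ ⁺ ∷ Δ) (σ ⁺)
  A₃ = itP v2 v1 v0

  P₃ : Poly (Step ⁺ ∷ σ ⁺ ∷ Δ) ((o ⇒ σ) ⁺)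
  P₃ = Λ o σ A₃ zeroP

  B₂ : Poly ((o ⇒ σ) ⁻ ∷ Step ⁺ ∷ Step ⁺ ∷ σ ⁺ ∷ Δ) (Step ⁻)
  B₂ = cl pull₂ pull₂-closed ∙ v3 ∙ v2 ∙ v1 ∙ fstP v0 ∙ sndP v0

  P₂ : Poly (σ ⁺ ∷ Δ) ((Step ⇒ o ⇒ σ) ⁺)
  P₂ = Λ Step (o ⇒ σ) P₃ B₂

  B₁ : Poly ((Step ⇒ o ⇒ σ) ⁻ ∷ σ ⁺ ∷ σ ⁺ ∷ Δ) (σ ⁻)
  B₁ = cl pull₁ pull₁-closed ∙ v2 ∙ v1 ∙ fstP v0 ∙ fstP (sndP v0) ∙ sndP (sndP v0)

  P₁ : Poly Δ ((σ ⇒ Step ⇒ o ⇒ σ) ⁺)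
  P₁ = Λ σ (Step ⇒ o ⇒ σ) P₂ B₁

  is-dom : Dom Γ (σ ⇒ Step ⇒ o ⇒ σ) (⟦ P₁ ⟧ [])
  is-dom = Λ-dom σ (Step ⇒ o ⇒ σ) P₂ B₁ []
    (λ p {x} dx → Λ-dom Step (o ⇒ σ) P₃ B₂ (x ∷ [])
      (λ q {y} dy → Λ-dom o σ A₃ zeroP (y ∷ x ∷ [])
        (λ r _ → it-dom (wkD r (wkD q dx)) (wkD r dy) _)
        -- Were the two numbers equal, the given evidence would set a value apart from itself.
        (λ r _ _ a → app! (⊃I′ λ s e → app-irrefl σ (respA (≐r ·≐ e) ≐r ≐r (wkA s a)))))
      (λ q {y} {y′} dy dy′ a → reflect₂ (wkD q dx) dy dy′ (Λ-app o σ A₃ zeroP (y ∷ x ∷ []) (y′ ∷ x ∷ []) a)))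
    (λ p {x} {x′} {w} dx dx′ a → reflect₁ dx dx′ (app-⇒E₁ a)
      (Λ-app o σ A₃ zeroP (fstT w ∷ x ∷ []) (fstT w ∷ x′ ∷ [])
        (Λ-app Step (o ⇒ σ) P₃ B₂ (x ∷ []) (x′ ∷ []) a)))

  eqn : ∀ {x y m} → Γ ⊩ ⟦ P₁ ⟧ [] ⋆ x ⋆ y ⋆ m ≐ it · x · y · m
  eqn {x = x} {y} =
    ((Λ-⋆ σ (Step ⇒ o ⇒ σ) P₂ B₁ [] ⋆≐ ≐r) ⋆≐ ≐r) ◾
    (Λ-⋆ Step (o ⇒ σ) P₃ B₂ (x ∷ []) ⋆≐ ≐r) ◾
    Λ-⋆ o σ A₃ zeroP (y ∷ x ∷ [])

constP : Const σ → Poly [] (σ ⁺)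
constP (kc ρ σ) = K⁺.P₁ ρ σ
constP (sc ρ σ τ) = S⁺.P₁ ρ σ τ
constP (pairc σ τ) = Pair⁺.P₁ σ τ
constP (fstc σ τ) = Fst⁺.P₁ σ τ
constP (sndc σ τ) = Snd⁺.P₁ σ τ
constP zeroc = zeroP
constP succ = Succ⁺.P₁
constP (recc σ) = Rec⁺.P₁ σ

const⁺ : ConstAssignment
const⁺ σ c = ⟦ constP c ⟧ []

const⁺-closed : ∀ σ (c : Const σ) → Closed (const⁺ σ c)
const⁺-closed σ c = ⟦⟧-closed (constP c)

const⁺-dom : (c : Const σ) → Dom Γ σ (const⁺ σ c)
const⁺-dom (kc ρ σ) = K⁺.is-dom ρ σ
const⁺-dom (sc ρ σ τ) = S⁺.is-dom ρ σ τ
const⁺-dom (pairc σ τ) = Pair⁺.is-dom σ τ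
const⁺-dom (fstc σ τ) = Fst⁺.is-dom σ τ
const⁺-dom (sndc σ τ) = Snd⁺.is-dom σ τ
const⁺-dom zeroc = dom-o
const⁺-dom succ = Succ⁺.is-dom
const⁺-dom (recc σ) = Rec⁺.is-dom σ

-- The translation

eqFm : ∀ σ → Tm (σ ⁺) → Tm (σ ⁺) → Fm HAω
eqFm σ x y = ¬ᶠ (∃ᶠ (σ ⁻) n (app σ x y (var n)))
  where n = fresh x ⊔ fresh y

module _ (σ : Ty) (x y : Tm (σ ⁺)) where
  private
    n : ℕ
    n = fresh x ⊔ fresh y

    P : Fm HAω
    P = app σ x y (var n)

    Separated : Fam (σ ⁻ ∷ σ ⁺ ∷ σ ⁺ ∷ [])
    Separated = appF σ v1 v2 v0 ⊃F ⊥F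

    names : Names (λ τ k → NotIn τ k (x ∷ y ∷ [])) (σ ⁻ ∷ []) n
    names = (fresh-∉ x (m≤m⊔n _ _) , fresh-∉ y (m≤n⊔m (fresh x) _) , tt) , tt

    bound : (if eqV (σ ⁻) n (σ ⁻) n then false else freeIn (σ ⁻) n P) ≡ false
    bound = cong (if_then false else freeIn (σ ⁻) n P) (eqV-refl (σ ⁻) n)

    bound¬ : (if eqV (σ ⁻) n (σ ⁻) n then false else (freeIn (σ ⁻) n P ∨ false)) ≡ false
    bound¬ = cong (if_then false else (freeIn (σ ⁻) n P ∨ false)) (eqV-refl (σ ⁻) n)

  -- The bound name is dictated by `x` and `y` and may be free in `Γ`; the universal form of the
  -- negation lets `∀*-intro` deal with this.
  eq-intro : (∀ {Γ′} → Γ′ ⊩ Γ → ∀ {z} → App Γ′ σ x y z → Γ′ ⊩ ⊥ᶠ) → Γ ⊩ eqFm σ x y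
  eq-intro {Γ} f = wk none (⊃I′ λ w e → ap (ap (thm (∃E n (∨-false bound¬ refl) (⊃I′ λ p g → ap (∀-own n g) p))) e) w)
    where
    none : Γ ⊩ ∀ᶠ (σ ⁻) n (¬ᶠ P)
    none = ∀*-intro {Δ = _ ∷ []} Separated (x ∷ y ∷ []) n names λ { (z ∷ []) → ⊃I′ λ w a → f w {z} (app! a) }

  eq-elim : Γ ⊩ eqFm σ x y → ∀ {z} → App Γ σ x y z → Γ ⊩ ψ
  eq-elim h {z} (app! a) = exfalso (ap (∀*-elim {Δ = _ ∷ []} Separated (x ∷ y ∷ []) n names (wk h none) (z ∷ [])) a)
    where
    none : eqFm σ x y ⊩ ∀ᶠ (σ ⁻) n (¬ᶠ P)
    none = ∀I n (∨-false bound refl) (⊃I′ λ w a → ap w (∃-own n a))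

eq-resp : ∀ {x x′ y y′} → Γ ⊩ x ≐ x′ → Γ ⊩ y ≐ y′ → Γ ⊩ eqFm σ x y → Γ ⊩ eqFm σ x′ y′
eq-resp {σ = σ} p q h = eq-intro σ _ _ λ w a →
  eq-elim σ _ _ (wk w h) (respA (≐s (wk w p)) (≐s (wk w q)) ≐r a)

eq-free : ∀ σ {k} x y → occursTm ρ k x ≡ false → occursTm ρ k y ≡ false → freeIn ρ k (eqFm σ x y) ≡ false
eq-free {ρ} σ {k} x y p q =
  ∨-false (if-false (eqV (σ ⁻) (fresh x ⊔ fresh y) ρ k) λ b → app-free σ x y (var (fresh x ⊔ fresh y)) p q b) refl

eqF : ∀ σ → Poly Δ (σ ⁺) → Poly Δ (σ ⁺) → Fam Δ
fm (eqF σ p q) e = eqFm σ (⟦ p ⟧ e) (⟦ q ⟧ e)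
resp (eqF σ p q) e e′ w = eq-resp (⟦⟧-cong p e e′ w) (⟦⟧-cong q e e′ w)
free (eqF σ p q) e w = eq-free σ (⟦ p ⟧ e) (⟦ q ⟧ e) (⟦⟧-∉ p e w) (⟦⟧-∉ q e w)

-- The hypothesis amounts to a double negation of the equation, and `eqt` decides the equation.
eq-o : ∀ {x y : Tm o} → Γ ⊩ eqFm o x y → Γ ⊩ x ≐ y
eq-o {x = x} {y} h = by-cases (eqt · x · y)
  (λ w e → eqt-sound e)
  (λ w e → eq-elim o x y (wk w h) {zeroT} (app! (⊃I′ λ w′ q → ap (wk w′ e) (eqt-complete q))))

module Translation (α : VarAssignment) (α-inj : InjectiveVarAssignment α) where

  ⟪_⟫ : Tm σ → Tm (σ ⁺)
  ⟪_⟫ = trTm const⁺ α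

  tr : Fm Hω → Fm HAω
  tr = trFm const⁺ α

  α-distinct : ∀ σ m τ n → eqV σ m τ n ≡ false → eqV (σ ⁺) (α σ m) (τ ⁺) (α τ n) ≡ false
  α-distinct σ m τ n e = eqV-false λ p q →
    let (r , s) = α-inj σ τ m n p q in eqV-distinct σ m τ n e r s

  α-distinct⁻¹ : ∀ σ m τ n → eqV (σ ⁺) (α σ m) (τ ⁺) (α τ n) ≡ false → eqV σ m τ n ≡ false
  α-distinct⁻¹ σ m τ n e = eqV-false {σ} {m} {τ} {n} λ { refl refl → eqV-distinct (σ ⁺) (α σ m) (σ ⁺) (α σ m) e refl refl }

  tm-∉ : ∀ {n} (t : Tm σ) → occursTm τ n t ≡ false → occursTm (τ ⁺) (α τ n) ⟪ t ⟫ ≡ false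
  tm-∉ {τ = τ} {n} (var {σ} m) e = α-distinct σ m τ n e
  tm-∉ (con c) e = closed-∉ (const⁺ _ c) (const⁺-closed _ c)
  tm-∉ (s · t) e = ∨-false (tm-∉ s (∨-conicalˡ _ _ e)) (tm-∉ t (∨-conicalʳ _ _ e))

  tr-∉ : ∀ {n} φ → freeIn τ n φ ≡ false → freeIn (τ ⁺) (α τ n) (tr φ) ≡ false
  tr-∉ ⊥ᶠ e = refl
  tr-∉ (s ≐ t) e = ∨-false (tm-∉ s (∨-conicalˡ _ _ e)) (tm-∉ t (∨-conicalʳ _ _ e))
  tr-∉ (Ext {σ} t) e = dom-free σ ⟪ t ⟫ (tm-∉ t e)
  tr-∉ (_==_ {σ} s t) e = eq-free σ ⟪ s ⟫ ⟪ t ⟫ (tm-∉ s (∨-conicalˡ _ _ e)) (tm-∉ t (∨-conicalʳ _ _ e))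
  tr-∉ (φ ∧ᶠ ψ) e = ∨-false (tr-∉ φ (∨-conicalˡ _ _ e)) (tr-∉ ψ (∨-conicalʳ _ _ e))
  tr-∉ (φ ∨ᶠ ψ) e = ∨-false (tr-∉ φ (∨-conicalˡ _ _ e)) (tr-∉ ψ (∨-conicalʳ _ _ e))
  tr-∉ (φ ⊃ ψ) e = ∨-false (tr-∉ φ (∨-conicalˡ _ _ e)) (tr-∉ ψ (∨-conicalʳ _ _ e))
  tr-∉ {τ} {n} (∀ᶠ σ m φ) e = if-false (eqV (σ ⁺) (α σ m) (τ ⁺) (α τ n)) λ b →
    tr-∉ φ (if-false⁻¹ e (α-distinct⁻¹ σ m τ n b))
  tr-∉ {τ} {n} (∃ᶠ σ m φ) e = if-false (eqV (σ ⁺) (α σ m) (τ ⁺) (α τ n)) λ b →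
    tr-∉ φ (if-false⁻¹ e (α-distinct⁻¹ σ m τ n b))

  -- Substitution under the translation

  tm-leibniz : ∀ {n} {s t : Tm τ} (r : Tm σ) → Γ ⊩ ⟪ s ⟫ ≐ ⟪ t ⟫ → Γ ⊩ ⟪ subTm n s r ⟫ ≐ ⟪ subTm n t r ⟫
  tm-leibniz {τ} {σ} {n = n} (var m) q with τ ≟T σ | m N.≟ n
  ... | yes refl | yes _ = q
  ... | yes refl | no _  = ≐r
  ... | no _     | _     = ≐r
  tm-leibniz (con c) q = ≐r
  tm-leibniz (r · r′) q = tm-leibniz r q ⋆≐ tm-leibniz r′ q

  -- The translated instances are not substitution instances of tr φ, because dom and app
  -- rename their bound variables; they only depend congruently on the translated term.
  leibniz : ∀ {n} {s t : Tm τ} φ → freeFor n s φ ≡ true → freeFor n t φ ≡ true →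
            ⟪ s ⟫ ≐ ⟪ t ⟫ ⊩ tr (subF n s φ) ⊃ tr (subF n t φ)
  leibniz-sym : ∀ {n} {s t : Tm τ} φ → freeFor n s φ ≡ true → freeFor n t φ ≡ true →
            ⟪ s ⟫ ≐ ⟪ t ⟫ ⊩ tr (subF n t φ) ⊃ tr (subF n s φ)
  -- Substitutability bars the bound variable from both terms, so its image is not free in the
  -- equation and the quantifier rules apply beneath it.
  leibniz-body : ∀ {n m} {s t : Tm τ} φ →
            (not (occursTm σ m s) ∧ freeFor n s φ) ≡ true →
            (not (occursTm σ m t) ∧ freeFor n t φ) ≡ true →
            freeIn {HAω} (σ ⁺) (α σ m) (⟪ s ⟫ ≐ ⟪ t ⟫) ≡ false × (⟪ s ⟫ ≐ ⟪ t ⟫ ⊩ tr (subF n s φ) ⊃ tr (subF n t φ))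
  leibniz-sym φ a b = wk (≐s hyp) (leibniz φ b a)
  leibniz-body {σ = σ} {m = m} {s} {t} φ a b =
    ∨-false (tm-∉ s (not-true (∧-conicalˡ _ _ a))) (tm-∉ t (not-true (∧-conicalˡ _ _ b))) ,
    leibniz φ (∧-conicalʳ _ _ a) (∧-conicalʳ _ _ b)
    where
    not-true : ∀ {c} → not c ≡ true → c ≡ false
    not-true {false} _ = refl
  leibniz ⊥ᶠ a b = thm hyp
  leibniz (r ≐ r′) a b = ⊃I′ λ q h → ≐s (tm-leibniz r q) ◾ h ◾ tm-leibniz r′ q
  leibniz (Ext {σ} r) a b = ⊃I′ λ q h → Dom.prf (respD (tm-leibniz r q) (dom! {σ = σ} h))
  leibniz (_==_ {σ} r r′) a b = ⊃I′ λ q h → eq-resp {σ = σ} (tm-leibniz r q) (tm-leibniz r′ q) h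
  leibniz (φ ∧ᶠ ψ) a b = ⊃I′ λ q h → ∧I′
    (ap (wk q (leibniz φ (∧-conicalˡ _ _ a) (∧-conicalˡ _ _ b))) (∧E₁′ h))
    (ap (wk q (leibniz ψ (∧-conicalʳ _ _ a) (∧-conicalʳ _ _ b))) (∧E₂′ h))
  leibniz (φ ∨ᶠ ψ) a b = ⊃I′ λ q h → cases h
    (λ w k → ap (thm ∨I₁) (ap (wk (wk w q) (leibniz φ (∧-conicalˡ _ _ a) (∧-conicalˡ _ _ b))) k))
    (λ w k → ap (thm ∨I₂) (ap (wk (wk w q) (leibniz ψ (∧-conicalʳ _ _ a) (∧-conicalʳ _ _ b))) k))
  leibniz (φ ⊃ ψ) a b = ⊃I′ λ q h → ⊃I′ λ w k →
    ap (wk (wk w q) (leibniz ψ (∧-conicalʳ _ _ a) (∧-conicalʳ _ _ b)))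
      (ap (wk w h) (ap (wk (wk w q) (leibniz-sym φ (∧-conicalˡ _ _ a) (∧-conicalˡ _ _ b))) k))
  leibniz {τ} {n} {s} {t} (∀ᶠ σ m φ) a b with eqV σ m τ n
  ... | true = thm hyp
  ... | false with freeIn τ n φ in fr
  -- Substitutability says nothing about the binder here, but both substitutions are the identity.
  ...   | false rewrite subF-∉ {t = s} φ fr | subF-∉ {t = t} φ fr = thm hyp
  ...   | true with leibniz-body {m = m} {s} {t} φ a b
  ...     | m∉E , ih = ⊃I (∀I (α σ m) (∨-false m∉E (cong (if_then false else freeIn (σ ⁺) (α σ m) (tr (subF n s φ))) (eqV-refl (σ ⁺) (α σ m))))
                         (ap (wk ∧E₁ ih) (∀-own (α σ m) ∧E₂)))
  leibniz {τ} {n} {s} {t} (∃ᶠ σ m φ) a b with eqV σ m τ n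
  ... | true = thm hyp
  ... | false with freeIn τ n φ in fr
  ...   | false rewrite subF-∉ {t = s} φ fr | subF-∉ {t = t} φ fr = thm hyp
  ...   | true with leibniz-body {m = m} {s} {t} φ a b
  ...     | m∉E , ih = ⊃I′ λ q h → ap (ap (thm (∃E (α σ m)
              (∨-false m∉E (cong (if_then false else freeIn (σ ⁺) (α σ m) (tr (subF n t φ))) (eqV-refl (σ ⁺) (α σ m))))
              (⊃I′ λ k q′ → ∃-own (α σ m) (ap (wk q′ ih) k)))) h) q

  bound-∀ : ∀ σ n (φ : Fm Hω) → freeIn σ n (∀ᶠ σ n φ) ≡ false
  bound-∀ σ n φ = cong (if_then false else freeIn σ n φ) (eqV-refl σ n)

  bound-∃ : ∀ σ n (φ : Fm Hω) → freeIn σ n (∃ᶠ σ n φ) ≡ false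
  bound-∃ σ n φ = cong (if_then false else freeIn σ n φ) (eqV-refl σ n)

  replaced : ∀ {n} (t : Tm σ) φ → occursTm σ n t ≡ false → freeIn {Hω} σ n (subF n t φ) ≡ false
  replaced {σ} {n} t φ e = subF-free {ρ = σ} {n} φ (λ d → contradiction refl (eqV-distinct σ n σ n d refl)) e

  freeFor-fresh : ∀ {n m} (φ : Fm Hω) → freshF φ ≤ m → freeFor n (var {σ} m) φ ≡ true
  freeFor-fresh {σ} {n} {m} φ le = freeFor-avoid φ λ τ k lt _ →
    ∉-var {σ} {τ} (λ e → <-irrefl (sym e) (<-≤-trans lt le))

  tr-self : ∀ n φ → Γ ⊩ tr φ → Γ ⊩ tr (subF n (var {σ} n) φ)
  tr-self {Γ} n φ = subst (λ ψ → Γ ⊩ tr ψ) (sym (subF-self n φ))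

  tr-self⁻¹ : ∀ n φ → Γ ⊩ tr (subF n (var {σ} n) φ) → Γ ⊩ tr φ
  tr-self⁻¹ {Γ} n φ = subst (λ ψ → Γ ⊩ tr ψ) (subF-self n φ)

  -- Both quantifier axioms pass through a fresh variable m, since t may contain n.
  module Instance {σ} (n : ℕ) (t : Tm σ) (φ : Fm Hω) (ff : freeFor n t φ ≡ true) where
    m : ℕ
    m = suc n ⊔ (freshF φ ⊔ fresh t)

    n≢m : n ≢ m
    n≢m = <⇒≢ (m≤m⊔n (suc n) (freshF φ ⊔ fresh t))

    φ≤m : freshF φ ≤ m
    φ≤m = ≤-trans (m≤m⊔n _ _) (m≤n⊔m (suc n) _)

    n∉m : occursTm σ n (var {σ} m) ≡ false
    n∉m = ∉-var {σ} {σ} λ e → n≢m (sym e)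

    m∉n : occursTm σ m (var {σ} n) ≡ false
    m∉n = ∉-var {σ} {σ} n≢m

    m∉t : occursTm σ m t ≡ false
    m∉t = fresh-∉ t (≤-trans (m≤n⊔m (freshF φ) _) (m≤n⊔m (suc n) _))

    m∉φ : freeIn σ m φ ≡ false
    m∉φ = freshF-∉ φ φ≤m

    m∉φ[t] : freeIn σ m (subF n t φ) ≡ false
    m∉φ[t] = subF-free {ρ = σ} {k = m} φ (λ _ → m∉φ) m∉t

    ∀-instance : tr (∀ᶠ σ n φ) ⊩ tr (subF n t φ)
    ∀-instance = letEq (α σ m) ⟪ t ⟫
      (tr-∉ (∀ᶠ σ n φ) (if-false (eqV σ n σ m) λ _ → m∉φ)) (tm-∉ t m∉t) (tr-∉ (subF n t φ) m∉φ[t])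
      (ap (wk ∧E₂ (leibniz φ (freeFor-fresh φ φ≤m) ff)) (wk ∧E₁
        (letEq (α σ n) ⟪ var {σ} m ⟫
          (tr-∉ (∀ᶠ σ n φ) (bound-∀ σ n φ)) (tm-∉ (var {σ} m) n∉m) (tr-∉ (subF n (var m) φ) (replaced (var m) φ n∉m))
          (ap (wk ∧E₂ (leibniz φ (freeFor-self n φ) (freeFor-fresh φ φ≤m)))
            (tr-self n φ (∀-own (α σ n) ∧E₁))))))

    ∃-instance : tr (subF n t φ) ⊩ tr (∃ᶠ σ n φ)
    ∃-instance = letEq (α σ m) ⟪ t ⟫
      (tr-∉ (subF n t φ) m∉φ[t]) (tm-∉ t m∉t) (tr-∉ (∃ᶠ σ n φ) (if-false (eqV σ n σ m) λ _ → m∉φ))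
      (wk (ap (wk ∧E₂ (leibniz-sym φ (freeFor-fresh φ φ≤m) ff)) ∧E₁)
        (letEq (α σ n) ⟪ var {σ} m ⟫
          (tr-∉ (subF n (var m) φ) (replaced (var m) φ n∉m)) (tm-∉ (var {σ} m) n∉m) (tr-∉ (∃ᶠ σ n φ) (bound-∃ σ n φ))
          (∃-own (α σ n) (tr-self⁻¹ n φ
            (ap (wk ∧E₂ (leibniz-sym φ (freeFor-self n φ) (freeFor-fresh φ φ≤m))) ∧E₁)))))

  -- Induction on k in ∀ n (n ≐ k ⊃ φ), for the same reason as in the lemma induction.
  module Induction (n : ℕ) (φ : Fm Hω) where
    open Instance n (con zeroc) φ (freeFor-avoid φ λ _ _ _ _ → refl)

    n⁺ m⁺ : ℕ
    n⁺ = α o n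
    m⁺ = α o m

    Sn Sm : Tm o
    Sn = con succ · var n
    Sm = con succ · var m

    premises : Fm Hω
    premises = subF n (con {o} zeroc) φ ∧ᶠ ∀ᶠ o n (φ ⊃ subF n Sn φ)

    n∉premises : freeIn {HAω} o n⁺ (tr premises) ≡ false
    n∉premises = tr-∉ premises (∨-false (replaced {n = n} (con zeroc) φ refl) (bound-∀ o n (φ ⊃ subF n Sn φ)))

    m∉premises : freeIn {HAω} o m⁺ (tr premises) ≡ false
    m∉premises = tr-∉ premises (∨-false m∉φ[t]
      (if-false (eqV o n o m) λ _ → ∨-false m∉φ (subF-free {ρ = o} {k = m} φ (λ _ → m∉φ) m∉n)))

    Φ : Tm o → Fm HAω
    Φ u = ∀ᶠ o n⁺ (var n⁺ ≐ u ⊃ tr φ)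

    n∉Φ : ∀ u → freeIn o n⁺ (Φ u) ≡ false
    n∉Φ u = cong (if_then false else freeIn o n⁺ (var n⁺ ≐ u ⊃ tr φ)) (eqV-refl o n⁺)

    Φ-sub : ∀ u → subF m⁺ u (Φ (var m⁺)) ≡ Φ u
    Φ-sub u rewrite α-distinct o n o m m∉n =
      cong (∀ᶠ o n⁺) (cong₂ _⊃_
        (cong₂ _≐_ (subTm-∉ {t = u} (var n⁺) (α-distinct o n o m m∉n)) (subTm-var m⁺ u))
        (subF-∉ (tr φ) (tr-∉ φ m∉φ)))

    freeFor-Sm : freeFor n Sm φ ≡ true
    freeFor-Sm = freeFor-avoid φ λ τ k lt _ → ∉-var {o} {τ} λ e → <-irrefl (sym e) (<-≤-trans lt φ≤m)

    freeFor-Sn : freeFor n Sn φ ≡ true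
    freeFor-Sn = freeFor-avoid φ λ τ k _ d → eqV-sym τ k o n d

    -- Both universal hypotheses are opened at their own bound variable n, which is then identified
    -- with m; the congruence carries the instance at Sn over to Sm.
    φ-at-Sm : tr premises ∧ᶠ Φ (var m⁺) ⊩ tr (subF n Sm φ)
    φ-at-Sm = letEq n⁺ (var m⁺)
      (∨-false n∉premises (n∉Φ (var m⁺))) (α-distinct o m o n n∉m) (tr-∉ (subF n Sm φ) (replaced Sm φ n∉m))
      (ap (wk (≐r ⋆≐ ∧E₂) (leibniz {s = Sn} {Sm} φ freeFor-Sn freeFor-Sm))
        (ap (∀-own n⁺ (∧E₂′ (∧E₁′ ∧E₁))) (ap (∀-own n⁺ (∧E₂′ ∧E₁)) ∧E₂)))

    zeroCase : tr premises ⊩ Φ (con zeroc)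
    zeroCase = ∀I n⁺ n∉premises (⊃I (tr-self⁻¹ n φ
      (ap (wk ∧E₂ (leibniz-sym {s = var n} {con zeroc} φ (freeFor-self n φ) (freeFor-avoid φ λ _ _ _ _ → refl))) (∧E₁′ ∧E₁))))

    succCase : tr premises ∧ᶠ Φ (var m⁺) ⊩ Φ (succT (var m⁺))
    succCase = ∀I n⁺ (∨-false n∉premises (n∉Φ (var m⁺))) (⊃I (tr-self⁻¹ n φ
      -- The translation of `Sm` applies the translated constant and only provably equals the
      -- successor used by the induction axiom.
      (ap (wk (∧E₂ ◾ ≐s Succ⁺.eqn) (leibniz-sym {s = var n} {Sm} φ (freeFor-self n φ) freeFor-Sm)) (wk ∧E₁ φ-at-Sm))))

    all-Φ : tr premises ⊩ ∀ᶠ o m⁺ (Φ (var m⁺))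
    all-Φ = ap (ap (thm (ax (ind m⁺ (Φ (var m⁺)))))
      (subst (tr premises ⊩_) (sym (Φ-sub (con zeroc))) zeroCase))
      (∀I m⁺ m∉premises (⊃I (subst (tr premises ∧ᶠ Φ (var m⁺) ⊩_) (sym (Φ-sub (succT (var m⁺)))) succCase)))

    conclusion : tr premises ⊩ tr (∀ᶠ o n φ)
    conclusion = ∀I n⁺ n∉premises (letEq m⁺ (var n⁺) m∉premises (α-distinct o n o m m∉n) (tr-∉ φ m∉φ)
      (ap (∀-own n⁺ (∀-own m⁺ (wk ∧E₁ all-Φ))) (≐s ∧E₂)))

  -- Soundness of axioms and rules

  sound-base : ∀ {φ} → BaseAx Hω φ → Γ ⊩ tr φ
  sound-base (≐-refl t) = ≐r
  sound-base (≐-sym s t) = thm (ax (≐-sym _ _))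
  sound-base (≐-trans r s t) = thm (ax (≐-trans _ _ _))
  sound-base (≐-app f f′ x x′) = ⊃I′ λ _ p → ⊃I′ λ w q → wk w p ⋆≐ q
  sound-base (k-ax {ρ} {σ} x y) = K⁺.eqn ρ σ
  sound-base (s-ax {ρ} {σ} {τ} x y z) = S⁺.eqn ρ σ τ
  sound-base (fst-ax {σ} {τ} x y) = Fst⁺.eqn σ τ ◾ fst≐ (Pair⁺.eqn σ τ) ◾ fst-pair
  sound-base (snd-ax {σ} {τ} x y) = Snd⁺.eqn σ τ ◾ snd≐ (Pair⁺.eqn σ τ) ◾ snd-pair
  sound-base (R0-ax {σ} x y) = Rec⁺.eqn σ ◾ Rec⁺.it-zero σ
  sound-base (RS-ax {σ} x y m) =
    Rec⁺.eqn σ ◾ (≐r ·≐ Succ⁺.eqn) ◾ Rec⁺.it-succ σ ◾ (≐r ⋆≐ ≐s (Rec⁺.eqn σ))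
  sound-base (S-inj x y) = ⊃I′ λ _ h → ap (thm (ax (S-inj _ _))) (≐s Succ⁺.eqn ◾ h ◾ Succ⁺.eqn)
  sound-base (S-ne0 x) = ⊃I′ λ _ h → ap succ≢zero (≐s Succ⁺.eqn ◾ h)
  sound-base (ind n φ) = ⊃I′ λ _ a → ⊃I′ λ w b → wk (∧I′ (wk w a) b) (Induction.conclusion n φ)

  sound-hax : ∀ {φ} → HAx φ → Γ ⊩ tr φ
  sound-hax (eq0 x y) = ∧I′ (⊃I′ λ _ h → eq-o h)
    (⊃I′ λ _ h → eq-intro o ⟪ x ⟫ ⟪ y ⟫ λ { w (app! a) → ap a (wk w h) })
  sound-hax (ext0 n) = thm (closeHyp (∀I (α o n) refl (thm (hyp {⊥ᶠ}))))
  sound-hax (eq⊗ {σ} {τ} x y) = ∧I′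
    (⊃I′ λ _ h → ∧I′
      (eq-intro σ _ _ λ w a → eq-elim (σ ⊗ τ) ⟪ x ⟫ ⟪ y ⟫ (wk w h)
        (Fst⁺.reflect σ τ (respA (Fst⁺.eqn σ τ) (Fst⁺.eqn σ τ) ≐r a)))
      (eq-intro τ _ _ λ w a → eq-elim (σ ⊗ τ) ⟪ x ⟫ ⟪ y ⟫ (wk w h)
        (Snd⁺.reflect σ τ (respA (Snd⁺.eqn σ τ) (Snd⁺.eqn σ τ) ≐r a))))
    (⊃I′ λ _ h → eq-intro (σ ⊗ τ) ⟪ x ⟫ ⟪ y ⟫ λ w {z} a → by-cases (sndT z)
      (λ r e → eq-elim σ _ _ (wk r (wk w (∧E₁′ h)))
        (respA (≐s (Fst⁺.eqn σ τ)) (≐s (Fst⁺.eqn σ τ)) ≐r (app-⊗E₁ (wkA r a) e)))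
      (λ r e → eq-elim τ _ _ (wk r (wk w (∧E₂′ h)))
        (respA (≐s (Snd⁺.eqn σ τ)) (≐s (Snd⁺.eqn σ τ)) ≐r (app-⊗E₂ (wkA r a) e))))
  sound-hax (ext⊗ {σ} {τ} x) = ∧I′
    (⊃I′ λ _ h → ∧I′
      (Dom.prf (respD (≐s (Fst⁺.eqn σ τ)) (dom-⊗E₁ {σ = σ} {τ} (dom! h))))
      (Dom.prf (respD (≐s (Snd⁺.eqn σ τ)) (dom-⊗E₂ {σ = σ} {τ} (dom! h)))))
    (⊃I′ λ _ h → Dom.prf (dom-⊗I {σ = σ} {τ}
      (respD (Fst⁺.eqn σ τ) (dom! (∧E₁′ h))) (respD (Snd⁺.eqn σ τ) (dom! (∧E₂′ h)))))
  sound-hax (eq⇒ {σ} {τ} f g n n∉f n∉g) = ∧I′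
    (thm (∀I (α σ n) (tr-∉ (f == g) (∨-false n∉f n∉g))
      (⊃I′ λ h d → eq-intro τ _ _ λ w a → eq-elim (σ ⇒ τ) ⟪ f ⟫ ⟪ g ⟫ (wk w h) (app-⇒I (dom! (wk w d)) a))))
    (⊃I′ λ _ h → eq-intro (σ ⇒ τ) ⟪ f ⟫ ⟪ g ⟫ λ w a → eq-elim τ _ _
      -- The point contained in the evidence instantiates the pointwise equality, and the domain
      -- condition in `app` supplies its premise. The bound name is any name absent from `f` and
      -- `g`, hence the general elimination.
      (ap (∀*-elim {Δ = _ ∷ []} Pointwise (⟪ f ⟫ ∷ ⟪ g ⟫ ∷ []) (α σ n) ((tm-∉ f n∉f , tm-∉ g n∉g , tt) , tt) (wk w h) (_ ∷ []))
        (Dom.prf (app-⇒E₁ a)))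
      (app-⇒E₂ a))
    where
    Pointwise : Fam (σ ⁺ ∷ (σ ⇒ τ) ⁺ ∷ (σ ⇒ τ) ⁺ ∷ [])
    Pointwise = domF σ v0 ⊃F eqF τ (v1 ⋆ₚ v0) (v2 ⋆ₚ v0)
  sound-hax (extApp {σ} {τ} f x) = ⊃I′ λ _ h → ⊃I′ λ w k →
    Dom.prf (dom-· {σ = σ} {τ} (dom! (wk w h)) (dom! k))
  sound-hax (ext≐ {σ} x y) = ⊃I′ λ _ q → ⊃I′ λ w h → Dom.prf (respD {σ = σ} (wk w q) (dom! h))
  sound-hax (extCon c) = Dom.prf (const⁺-dom c)

  sound-ax : ∀ {φ} → HE-HA φ → Γ ⊩ tr φ
  sound-ax (h-ha (base a)) = sound-base a
  sound-ax (h-ha (hax a)) = sound-hax a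
  sound-ax (ext {σ} {τ} f x y) = ⊃I′ λ _ df → ⊃I′ λ p dx → ⊃I′ λ q dy → ⊃I′ λ r e →
    eq-intro τ _ _ λ w a → eq-elim σ ⟪ x ⟫ ⟪ y ⟫ (wk w e)
      (dom-reflect {σ = σ} {τ} (dom! (wk w (wk r (wk q (wk p df))))) (dom! (wk w (wk r (wk q dx)))) (dom! (wk w (wk r dy))) a)

  sound : ∀ {φ} → HE-HA ⊢ φ → HA ⊢ tr φ
  sound (ax a) = closeHyp (sound-ax a)
  sound (mp d e) = mp (sound d) (sound e)
  sound K = K
  sound S = S
  sound ∧I = ∧I
  sound ∧E₁ = ∧E₁
  sound ∧E₂ = ∧E₂
  sound ∨I₁ = ∨I₁
  sound ∨I₂ = ∨I₂
  sound ∨E = ∨E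
  sound efq = efq
  sound (∀E n t φ ff) = Instance.∀-instance n t φ ff
  sound (∃I n t φ ff) = Instance.∃-instance n t φ ff
  sound (∀I {σ} n {ψ = ψ} e d) = ∀I (α σ n) (tr-∉ ψ e) (sound d)
  sound (∃E {σ} n {ψ = ψ} e d) = ∃E (α σ n) (tr-∉ ψ e) (sound d)

theorem5p5 : Σ ConstAssignment λ cα →
    ((σ : Ty) (c : Const σ) → Closed (cα σ c)) ×
    ((α : VarAssignment) → InjectiveVarAssignment α →
    (φ : Fm Hω) → HE-HA ⊢ φ → HA ⊢ trFm cα α φ)
theorem5p5 = const⁺ , const⁺-closed , λ α α-inj φ → Translation.sound α α-inj
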